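{- Let $f$ and $g$ be monic polynomials with integer coefficients, and assume that their resultant $r=R(f,g)$ is square-free. Then every positive divisor $d$ of $r$ arises as $\gcd(f(n),g(n))$ for some integer $n$. Moreover, for every positive divisor $d$ of $r$ and every set of $|r|$ consecutive integers, the number of integers $n$ in that set with $\gcd(f(n),g(n))=d$ is exactly $\prod_p (p-1)$, where the product is over all positive prime divisors $p$ of $r/d$. In particular, $|r|$ itself arises exactly once in each such set.
   Context: The resultant $R(f,g)$ of $f(x)=a_0x^k+\dots+a_k$ and $g(x)=b_0x^l+\dots+b_l$ is the determinant of the $(k+l)\times(k+l)$ Sylvester matrix, whose first $l$ rows are $(a_0,a_1,\dots,a_k)$ shifted successively one position to the right (padded with zeros), and whose last $k$ rows are $(b_0,b_1,\dots,b_l)$ shifted successively one position to the right (padded with zeros). Monic means $a_0=b_0=1$. -}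

module Defs where

open import Data.Nat as ℕ using (ℕ; zero; suc)
open import Data.Nat.Divisibility using (_∣_; _∣?_)
open import Data.Nat.Primality using (Prime; prime?)
open import Data.Integer as ℤ using (ℤ; +_)
open import Data.Fin as Fin using (Fin; toℕ; punchIn)
open import Data.Vec as Vec using (Vec; toList)
open import Data.List as List using (List; []; _∷_; upTo; filter; length; map)
open import Data.Nat.ListAction using (product)
open import Relation.Nullary.Decidable using (_×-dec_; yes; no)
open import Data.Integer.GCD renaming (gcd to gcdZ)
open import Relation.Binary.PropositionalEquality using (_≡_)

-- A polynomial of formal degree k with integer coefficients, written as
-- the vector (a_0, a_1, ..., a_k) of coefficients of f = a_0 x^k + ... + a_k.
Poly : ℕ → Set
Poly k = Vec ℤ (suc k)

Monic : ∀ {k} → Poly k → Set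
Monic f = Vec.head f ≡ ℤ.1ℤ

evalList : ℤ → ℤ → List ℤ → ℤ
evalList acc x []       = acc
evalList acc x (c ∷ cs) = evalList (acc ℤ.* x ℤ.+ c) x cs

eval : ∀ {k} → Poly k → ℤ → ℤ
eval f x = evalList ℤ.0ℤ x (toList f)

coeffList : List ℤ → ℕ → ℤ
coeffList []       _       = ℤ.0ℤ
coeffList (c ∷ cs) zero    = c
coeffList (c ∷ cs) (suc i) = coeffList cs i

coeff : ∀ {k} → Poly k → ℕ → ℤ
coeff f i = coeffList (toList f) i

shifted : ∀ {k} → Poly k → ℕ → ℕ → ℤ
shifted f s j with s ℕ.≤? j
... | yes _ = coeff f (j ℕ.∸ s)
... | no  _ = ℤ.0ℤ

sylvester : ∀ {k l} → Poly k → Poly l → Fin (k ℕ.+ l) → Fin (k ℕ.+ l) → ℤ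
sylvester {k} {l} f g i j with toℕ i ℕ.<? l
... | yes _ = shifted f (toℕ i) (toℕ j)
... | no  _ = shifted g (toℕ i ℕ.∸ l) (toℕ j)

sumFin : ∀ {n} → (Fin n → ℤ) → ℤ
sumFin {zero}  h = ℤ.0ℤ
sumFin {suc n} h = h Fin.zero ℤ.+ sumFin (λ j → h (Fin.suc j))

sign : ℕ → ℤ
sign zero          = ℤ.1ℤ
sign (suc zero)    = ℤ.-1ℤ
sign (suc (suc m)) = sign m

det : ∀ {n} → (Fin n → Fin n → ℤ) → ℤ
det {zero}  M = ℤ.1ℤ
det {suc n} M = sumFin λ j →
  sign (toℕ j) ℤ.* M Fin.zero j ℤ.* det (λ i' j' → M (Fin.suc i') (punchIn j j'))

resultant : ∀ {k l} → Poly k → Poly l → ℤ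
resultant f g = det (sylvester f g)

-- r square-free: no square m² with m ≠ 1 divides r (so in particular r ≠ 0).
SquareFree : ℤ → Set
SquareFree r = ∀ m → (m ℕ.* m) ∣ ℤ.∣ r ∣ → m ≡ 1

-- ∏ (p - 1) over the primes p dividing m (for m ≥ 1)
primeProd : ℕ → ℕ
primeProd m = product (map (λ p → p ℕ.∸ 1)
  (filter (λ p → prime? p ×-dec (p ∣? m)) (upTo (suc m))))

countGcd : ∀ {k l} → Poly k → Poly l → ℤ → ℕ → ℕ → ℕ
countGcd f g a N d = length (filter (λ i →
  gcdZ (eval f (a ℤ.+ + i)) (eval g (a ℤ.+ + i)) ℤ.≟ + d) (upTo N))

{-# OPTIONS --safe #-}
-- A vector c with M c ≡ 0 (mod p), for M the Sylvester matrix, is a linear functional on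
-- polynomials of degree < k + l vanishing mod p on all x^i f (i < l) and x^i g (i < k).
-- If p divides r = det M exactly once, these functionals form a line: some column of the
-- adjugate is nonzero mod p, while two independent kernel vectors would allow two columns of
-- M to be made divisible by p. The functional c ∘ (multiplication by x) also vanishes on the
-- multiples of f and g, so it is n · c mod p for some n; hence c is proportional to
-- evaluation at n, and n is the unique common root of f and g mod p. Evaluation at any n
-- likewise shows gcd (f n) (g n) ∣ r. The counts follow by the Chinese remainder theorem,
-- adding one prime of r at a time.

module Submission where

-- All arithmetic stays in the integers, with divisibility by `p` in place of a residue field.
-- Linear algebra mod `p` must then be read off integer determinants. This is the role of Cramer's
-- rule, which gives `d ∣ det M * c j` for a kernel vector `c` mod `d`, and of the adjugate. Both
-- rest on the product rule, to be derived for a determinant given as an expansion along its first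
-- row.
--
-- Multiplication by x leads from degree below k + l to degree k + l, so the functional must first
-- be given a value at x^(k + l). As f is monic, the value can be chosen so that x^l f is killed.
-- Then x^k g is killed too: f g is a combination of the x^i f with i ≤ l, and also x^k g plus a
-- combination of the x^i g with i < k.
--
-- For the counts, the common divisor is cut down to its gcd with a partial product B of the primes
-- of r, which makes it periodic of period B. A residue class mod B has p lifts mod p B, and exactly
-- one of them meets the root mod p.

module Determinants where

  open import Defs
  open import Data.Nat using (ℕ; zero; suc)
  open import Data.Integer using (ℤ; 0ℤ; 1ℤ; -1ℤ; _+_; _*_; -_; _-_; _^_)
  open import Data.Integer.Properties using (+-identityˡ; +-identityʳ; *-identityˡ; *-identityʳ; *-zeroʳ; *-zeroˡ; *-comm; -1*i≡-i; neg-distribˡ-*)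
  open import Data.Integer.Tactic.RingSolver using (solve-∀)
  open import Data.Fin using (Fin; zero; suc; toℕ; punchIn)
  open import Data.Fin.Properties using (_≟_; suc-injective)
  open import Data.Product using (∃; _,_)
  open import Data.Empty using (⊥-elim)
  open import Function using (_∘_)
  open import Relation.Nullary using (yes; no)
  open import Relation.Binary.PropositionalEquality

  private variable
    m n : ℕ
    A : Set

  -- Finite sums, unit vectors and updates of families.

  sumFin-cong : {h h' : Fin n → ℤ} → (∀ j → h j ≡ h' j) → sumFin h ≡ sumFin h'
  sumFin-cong {zero}  eq = refl
  sumFin-cong {suc n} eq = cong₂ _+_ (eq zero) (sumFin-cong (eq ∘ suc))

  sumFin-zero : {h : Fin n → ℤ} → (∀ j → h j ≡ 0ℤ) → sumFin h ≡ 0ℤ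
  sumFin-zero {zero}  eq = refl
  sumFin-zero {suc n} eq = cong₂ _+_ (eq zero) (sumFin-zero (eq ∘ suc))

  sumFin-+ : (h h' : Fin n → ℤ) → sumFin (λ j → h j + h' j) ≡ sumFin h + sumFin h'
  sumFin-+ {zero}  h h' = refl
  sumFin-+ {suc n} h h' = trans (cong (λ s → h zero + h' zero + s) (sumFin-+ (h ∘ suc) (h' ∘ suc)))
    (interchange (h zero) (h' zero) _ _)
    where
    interchange : ∀ a b c d → a + b + (c + d) ≡ a + c + (b + d)
    interchange = solve-∀

  *-sumFin : ∀ c (h : Fin n → ℤ) → c * sumFin h ≡ sumFin (λ j → c * h j)
  *-sumFin {zero}  c h = *-zeroʳ c
  *-sumFin {suc n} c h = trans (distrib c (h zero) _) (cong (λ s → c * h zero + s) (*-sumFin c (h ∘ suc)))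
    where
    distrib : ∀ a b c → a * (b + c) ≡ a * b + a * c
    distrib = solve-∀

  δ : Fin n → Fin n → ℤ
  δ zero    zero    = 1ℤ
  δ zero    (suc j) = 0ℤ
  δ (suc i) zero    = 0ℤ
  δ (suc i) (suc j) = δ i j

  sumFin-δʳ : ∀ (h : Fin n → ℤ) j → sumFin (λ i → h i * δ i j) ≡ h j
  sumFin-δʳ h zero = trans (cong₂ _+_ (*-identityʳ (h zero)) (sumFin-zero (λ i → *-zeroʳ (h (suc i)))))
    (+-identityʳ (h zero))
  sumFin-δʳ h (suc j) = trans (cong₂ _+_ (*-zeroʳ (h zero)) (sumFin-δʳ (h ∘ suc) j)) (+-identityˡ _)

  set : (Fin n → A) → Fin n → A → Fin n → A
  set xs zero    x zero    = x
  set xs zero    x (suc j) = xs (suc j)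
  set xs (suc i) x zero    = xs zero
  set xs (suc i) x (suc j) = set (xs ∘ suc) i x j

  set-≡ : ∀ (xs : Fin n → A) i x → set xs i x i ≡ x
  set-≡ xs zero    x = refl
  set-≡ xs (suc i) x = set-≡ (xs ∘ suc) i x

  set-≢ : ∀ (xs : Fin n → A) i x {j} → j ≢ i → set xs i x j ≡ xs j
  set-≢ xs zero    x {zero}  j≢i = ⊥-elim (j≢i refl)
  set-≢ xs zero    x {suc j} j≢i = refl
  set-≢ xs (suc i) x {zero}  j≢i = refl
  set-≢ xs (suc i) x {suc j} j≢i = set-≢ (xs ∘ suc) i x (j≢i ∘ cong suc)

  set-map : ∀ {B : Set} (φ : A → B) (xs : Fin n → A) i x j →
    φ (set xs i x j) ≡ set (φ ∘ xs) i (φ x) j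
  set-map φ xs zero    x zero    = refl
  set-map φ xs zero    x (suc j) = refl
  set-map φ xs (suc i) x zero    = refl
  set-map φ xs (suc i) x (suc j) = set-map φ (xs ∘ suc) i x j

  set-id : ∀ (xs : Fin n → A) i j → set xs i (xs i) j ≡ xs j
  set-id xs zero    zero    = refl
  set-id xs zero    (suc j) = refl
  set-id xs (suc i) zero    = refl
  set-id xs (suc i) (suc j) = set-id (xs ∘ suc) i j

  set-comm : ∀ (xs : Fin n → A) {i i'} → i ≢ i' → ∀ x y j →
    set (set xs i x) i' y j ≡ set (set xs i' y) i x j
  set-comm xs {zero}  {zero}   i≢i' x y j       = ⊥-elim (i≢i' refl)
  set-comm xs {zero}  {suc i'} i≢i' x y zero    = refl
  set-comm xs {zero}  {suc i'} i≢i' x y (suc j) = refl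
  set-comm xs {suc i} {zero}   i≢i' x y zero    = refl
  set-comm xs {suc i} {zero}   i≢i' x y (suc j) = refl
  set-comm xs {suc i} {suc i'} i≢i' x y zero    = refl
  set-comm xs {suc i} {suc i'} i≢i' x y (suc j) = set-comm (xs ∘ suc) (i≢i' ∘ cong suc) x y j

  set-cong₂ : ∀ {xs ys : Fin n → Fin m → ℤ} → (∀ j k → xs j k ≡ ys j k) →
    ∀ i {x y : Fin m → ℤ} → (∀ k → x k ≡ y k) → ∀ j k → set xs i x j k ≡ set ys i y j k
  set-cong₂ eq zero    eq' zero    k = eq' k
  set-cong₂ eq zero    eq' (suc j) k = eq (suc j) k
  set-cong₂ eq (suc i) eq' zero    k = eq zero k
  set-cong₂ eq (suc i) eq' (suc j) k = set-cong₂ (eq ∘ suc) i eq' j k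

  infixr 5 _◂_
  _◂_ : A → (Fin n → A) → Fin (suc n) → A
  (x ◂ xs) zero    = x
  (x ◂ xs) (suc i) = xs i

  -- Alternating multilinear functions of the rows of a matrix.

  Matrix : ℕ → ℕ → Set
  Matrix m n = Fin m → Fin n → ℤ

  infix 4 _≈_
  _≈_ : Matrix m n → Matrix m n → Set
  A ≈ B = ∀ i j → A i j ≡ B i j

  -- `ext` is a field because matrices are functions, compared only pointwise. Linearity is phrased
  -- through `set`, so that the other rows are shared by construction.
  record Alternating (F : Matrix m n → ℤ) : Set where
    field
      ext         : ∀ {A B} → A ≈ B → F A ≡ F B
      additive    : ∀ A i x y → F (set A i (λ j → x j + y j)) ≡ F (set A i x) + F (set A i y)
      homogeneous : ∀ A i c x → F (set A i (λ j → c * x j)) ≡ c * F (set A i x)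
      alternate   : ∀ A {i i'} → i ≢ i' → (∀ j → A i j ≡ A i' j) → F A ≡ 0ℤ

    ext-row : ∀ A i {x y} → (∀ j → x j ≡ y j) → F (set A i x) ≡ F (set A i y)
    ext-row A i eq = ext (set-cong₂ (λ _ _ → refl) i eq)

    zero-row : ∀ A i → F (set A i (λ _ → 0ℤ)) ≡ 0ℤ
    zero-row A i = homogeneous A i 0ℤ (λ _ → 0ℤ)

    linear : ∀ {k} A i (c : Fin k → ℤ) (X : Matrix k n) →
      F (set A i (λ j → sumFin (λ t → c t * X t j))) ≡ sumFin (λ t → c t * F (set A i (X t)))
    linear {zero}  A i c X = zero-row A i
    linear {suc k} A i c X = trans (additive A i _ _)
      (cong₂ _+_ (homogeneous A i (c zero) (X zero)) (linear A i (c ∘ suc) (X ∘ suc)))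

    -- Cofactor expansion along an arbitrary row, with cofactors left unevaluated. It serves the
    -- uniqueness of `det` as well as the adjugate.
    expand-row : ∀ A i x → F (set A i x) ≡ sumFin (λ t → x t * F (set A i (δ t)))
    expand-row A i x = trans (ext-row A i (λ j → sym (sumFin-δʳ x j))) (linear A i x δ)

    repeated-row : ∀ A {i i'} → i ≢ i' → ∀ x → F (set (set A i x) i' x) ≡ 0ℤ
    repeated-row A {i} {i'} i≢i' x = alternate _ i≢i' λ j →
      cong-app (trans (trans (set-≢ _ i' x i≢i') (set-≡ A i x)) (sym (set-≡ _ i' x))) j

    add-multiple : ∀ A {i i'} → i ≢ i' → ∀ x c →
      F (set A i (λ j → x j + c * A i' j)) ≡ F (set A i x)
    add-multiple A {i} {i'} i≢i' x c = begin
      F (set A i (λ j → x j + c * A i' j))          ≡⟨ additive A i _ _ ⟩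
      F (set A i x) + F (set A i (λ j → c * A i' j)) ≡⟨ cong (F (set A i x) +_) (homogeneous A i c (A i')) ⟩
      F (set A i x) + c * F (set A i (A i'))         ≡⟨ cong (λ z → F (set A i x) + c * z) (alternate (set A i (A i')) i≢i' same) ⟩
      F (set A i x) + c * 0ℤ                         ≡⟨ cong (F (set A i x) +_) (*-zeroʳ c) ⟩
      F (set A i x) + 0ℤ                             ≡⟨ +-identityʳ _ ⟩
      F (set A i x)                                  ∎
      where
      open ≡-Reasoning
      same : ∀ j → set A i (A i') i j ≡ set A i (A i') i' j
      same = cong-app (trans (set-≡ A i _) (sym (set-≢ A i _ (i≢i' ∘ sym))))

    -- Polarisation: placing `x + y` in both rows gives zero, and of its four terms the two with
    -- equal rows vanish as well.
    antisymmetric : ∀ A {i i'} → i ≢ i' → ∀ x y →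
      F (set (set A i x) i' y) ≡ - F (set (set A i y) i' x)
    antisymmetric A {i} {i'} i≢i' x y = cancel _ _ (begin
      F⟨ x , y ⟩ + F⟨ y , x ⟩
        ≡⟨ sym (cong₂ _+_ (+-identityˡ F⟨ x , y ⟩) (+-identityʳ F⟨ y , x ⟩)) ⟩
      (0ℤ + F⟨ x , y ⟩) + (F⟨ y , x ⟩ + 0ℤ)
        ≡⟨ sym (cong₂ (λ a b → (a + F⟨ x , y ⟩) + (F⟨ y , x ⟩ + b)) (repeated-row A i≢i' x) (repeated-row A i≢i' y)) ⟩
      (F⟨ x , x ⟩ + F⟨ x , y ⟩) + (F⟨ y , x ⟩ + F⟨ y , y ⟩)
        ≡⟨ sym (cong₂ _+_ (additive _ i' x y) (additive _ i' x y)) ⟩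
      F⟨ x , x+y ⟩ + F⟨ y , x+y ⟩
        ≡⟨ cong₂ _+_ (ext (commuted x)) (ext (commuted y)) ⟩
      F (set (set A i' x+y) i x) + F (set (set A i' x+y) i y)
        ≡⟨ sym (additive _ i x y) ⟩
      F (set (set A i' x+y) i x+y)
        ≡⟨ repeated-row A (i≢i' ∘ sym) x+y ⟩
      0ℤ ∎)
      where
      open ≡-Reasoning
      F⟨_,_⟩ : (Fin _ → ℤ) → (Fin _ → ℤ) → ℤ
      F⟨ u , v ⟩ = F (set (set A i u) i' v)
      x+y : Fin _ → ℤ
      x+y j = x j + y j
      commuted : ∀ u → set (set A i u) i' x+y ≈ set (set A i' x+y) i u
      commuted u j = cong-app (set-comm A i≢i' u x+y j)
      cancel : ∀ a b → a + b ≡ 0ℤ → a ≡ - b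
      cancel a b eq = trans (move a b) (trans (cong (_- b) eq) (+-identityˡ (- b)))
        where
        move : ∀ a b → a ≡ a + b - b
        move = solve-∀

  swapRows : Matrix m n → Fin m → Fin m → Matrix m n
  swapRows A i i' = set (set A i (A i')) i' (A i)

  swap-rows : ∀ {F : Matrix m n → ℤ} → Alternating F → ∀ A {i i'} → i ≢ i' → F A ≡ - F (swapRows A i i')
  swap-rows {F = F} alt A {i} {i'} i≢i' = trans (ext unchanged) (antisymmetric A i≢i' (A i) (A i'))
    where
    open Alternating alt
    unchanged : A ≈ set (set A i (A i)) i' (A i')
    unchanged t j with t ≟ i'
    ... | yes refl = cong-app (sym (set-≡ _ i' (A i'))) j
    ... | no t≢i' = cong-app (sym (trans (set-≢ _ i' (A i') t≢i') (set-id A i t))) j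

  Alternating-◂ : ∀ {F : Matrix (suc m) n → ℤ} → Alternating F → ∀ r → Alternating (λ A → F (r ◂ A))
  Alternating-◂ {F = F} alt r = record
    { ext         = λ eq → ext λ { zero j → refl ; (suc i) j → eq i j }
    ; additive    = λ A i x y → trans (under A i _) (trans (additive (r ◂ A) (suc i) x y)
        (sym (cong₂ _+_ (under A i x) (under A i y))))
    ; homogeneous = λ A i c x → trans (under A i _) (trans (homogeneous (r ◂ A) (suc i) c x)
        (sym (cong (c *_) (under A i x))))
    ; alternate   = λ A i≢i' eq → alternate (r ◂ A) (i≢i' ∘ suc-injective) eq
    }
    where
    open Alternating alt
    under : ∀ A i x → F (r ◂ set A i x) ≡ F (set (r ◂ A) (suc i) x)
    under A i x = ext λ { zero j → refl ; (suc t) j → refl }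

  sign-suc : ∀ m → sign (suc m) ≡ - sign m
  sign-suc zero          = refl
  sign-suc (suc zero)    = refl
  sign-suc (suc (suc m)) = sign-suc m

  -- Bringing row j to the front is a product of j adjacent transpositions.
  rotate-rows : ∀ {F : Matrix (suc m) n → ℤ} → Alternating F → ∀ R j →
    F (R j ◂ R ∘ punchIn j) ≡ sign (toℕ j) * F R
  rotate-rows {F = F} alt R zero =
    trans (Alternating.ext alt (λ { zero j → refl ; (suc i) j → refl })) (sym (*-identityˡ (F R)))
  rotate-rows {suc m} {F = F} alt R (suc j) = begin
    F (R (suc j) ◂ R ∘ punchIn (suc j))
      ≡⟨ swap-rows alt _ {zero} {suc zero} (λ ()) ⟩
    - F (swapRows (R (suc j) ◂ R ∘ punchIn (suc j)) zero (suc zero))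
      ≡⟨ cong -_ (Alternating.ext alt (λ { zero t → refl ; (suc zero) t → refl ; (suc (suc i)) t → refl })) ⟩
    - F (R zero ◂ R (suc j) ◂ R ∘ suc ∘ punchIn j)
      ≡⟨ cong -_ (rotate-rows (Alternating-◂ alt (R zero)) (R ∘ suc) j) ⟩
    - (sign (toℕ j) * F (R zero ◂ R ∘ suc))
      ≡⟨ cong (λ z → - (sign (toℕ j) * z)) (Alternating.ext alt (λ { zero t → refl ; (suc i) t → refl })) ⟩
    - (sign (toℕ j) * F R)
      ≡⟨ neg-distribˡ-* (sign (toℕ j)) (F R) ⟩
    - sign (toℕ j) * F R
      ≡⟨ cong (_* F R) (sym (sign-suc (toℕ j))) ⟩
    sign (suc (toℕ j)) * F R ∎
    where open ≡-Reasoning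

  -- Uniqueness of an alternating function of square matrices.

  insert0 : Fin (suc n) → (Fin n → ℤ) → Fin (suc n) → ℤ
  insert0 zero                x zero    = 0ℤ
  insert0 zero                x (suc k) = x k
  insert0 {n = suc n} (suc j) x zero    = x zero
  insert0 {n = suc n} (suc j) x (suc k) = insert0 j (x ∘ suc) k

  insert0-cong : ∀ (j : Fin (suc n)) {x y} → (∀ k → x k ≡ y k) → ∀ k → insert0 j x k ≡ insert0 j y k
  insert0-cong zero                eq zero    = refl
  insert0-cong zero                eq (suc k) = eq k
  insert0-cong {n = suc n} (suc j) eq zero    = eq zero
  insert0-cong {n = suc n} (suc j) eq (suc k) = insert0-cong j (eq ∘ suc) k

  insert0-+ : ∀ (j : Fin (suc n)) x y k → insert0 j (λ t → x t + y t) k ≡ insert0 j x k + insert0 j y k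
  insert0-+ zero                x y zero    = refl
  insert0-+ zero                x y (suc k) = refl
  insert0-+ {n = suc n} (suc j) x y zero    = refl
  insert0-+ {n = suc n} (suc j) x y (suc k) = insert0-+ j (x ∘ suc) (y ∘ suc) k

  insert0-* : ∀ (j : Fin (suc n)) c x k → insert0 j (λ t → c * x t) k ≡ c * insert0 j x k
  insert0-* zero                c x zero    = sym (*-zeroʳ c)
  insert0-* zero                c x (suc k) = refl
  insert0-* {n = suc n} (suc j) c x zero    = refl
  insert0-* {n = suc n} (suc j) c x (suc k) = insert0-* j c (x ∘ suc) k

  insert0-punchIn : ∀ (j : Fin (suc n)) x k → x k ≡ insert0 j (x ∘ punchIn j) k + x j * δ j k
  insert0-punchIn zero x zero    = sym (trans (+-identityˡ _) (*-identityʳ (x zero)))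
  insert0-punchIn zero x (suc k) = sym (trans (cong (x (suc k) +_) (*-zeroʳ (x zero))) (+-identityʳ _))
  insert0-punchIn {n = suc n} (suc j) x zero    = sym (trans (cong (x zero +_) (*-zeroʳ (x (suc j)))) (+-identityʳ _))
  insert0-punchIn {n = suc n} (suc j) x (suc k) = insert0-punchIn j (x ∘ suc) k

  insert0-zeros : ∀ (j : Fin (suc n)) k → insert0 j (λ _ → 0ℤ) k ≡ 0ℤ
  insert0-zeros zero zero = refl
  insert0-zeros zero (suc k) = refl
  insert0-zeros {n = suc n} (suc j) zero = refl
  insert0-zeros {n = suc n} (suc j) (suc k) = insert0-zeros j k

  insert0-δ : ∀ (j : Fin (suc n)) i k → insert0 j (δ i) k ≡ δ (punchIn j i) k
  insert0-δ zero    i       zero    = refl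
  insert0-δ zero    i       (suc k) = refl
  insert0-δ (suc j) zero    zero    = refl
  insert0-δ {n = suc n} (suc j) zero (suc k) = insert0-zeros j k
  insert0-δ (suc j) (suc i) zero    = refl
  insert0-δ (suc j) (suc i) (suc k) = insert0-δ j i k

  -- Rows are exchanged from the top, each finished row becoming part of the function. With the
  -- relation "differs by a multiple of `δ j`" this clears a whole column.
  replace-rows : ∀ {_∼_ : (Fin n → ℤ) → (Fin n → ℤ) → Set} (F : Matrix m n → ℤ) →
    (∀ {A B} → A ≈ B → F A ≡ F B) →
    (∀ A i {x y} → x ∼ y → F (set A i x) ≡ F (set A i y)) →
    ∀ A B → (∀ i → A i ∼ B i) → F A ≡ F B
  replace-rows {m = zero}  F ext row A B A∼B = ext λ ()
  replace-rows {m = suc m} {_∼_} F ext row A B A∼B = begin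
    F A                    ≡⟨ ext (λ { zero j → refl ; (suc i) j → refl }) ⟩
    F (set A zero (A zero)) ≡⟨ row A zero (A∼B zero) ⟩
    F (set A zero (B zero)) ≡⟨ ext (λ { zero j → refl ; (suc i) j → refl }) ⟩
    F (B zero ◂ A ∘ suc)
      ≡⟨ replace-rows {_∼_ = _∼_} (λ A' → F (B zero ◂ A')) (λ eq → ext λ { zero j → refl ; (suc i) j → eq i j })
           (λ A' i x∼y → trans (under A' i _) (trans (row (B zero ◂ A') (suc i) x∼y) (sym (under A' i _))))
           (A ∘ suc) (B ∘ suc) (A∼B ∘ suc) ⟩
    F (B zero ◂ B ∘ suc)   ≡⟨ ext (λ { zero j → refl ; (suc i) j → refl }) ⟩
    F B ∎
    where
    open ≡-Reasoning
    under : ∀ A' i x → F (B zero ◂ set A' i x) ≡ F (set (B zero ◂ A') (suc i) x)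
    under A' i x = ext λ { zero j → refl ; (suc t) j → refl }

  minor : Matrix (suc m) (suc n) → Fin (suc n) → Matrix m n
  minor A j i' j' = A (suc i') (punchIn j j')

  -- With `δ j` as first row, its multiples clear column `j` of the other rows. What remains is an
  -- alternating function of the minor, handled by induction. Only the recursion defining `det`
  -- enters, so the result can precede the proof that `det` is alternating.
  det-unique : ∀ {F : Matrix n n → ℤ} → Alternating F → ∀ A → F A ≡ det A * F δ
  det-unique {zero}  {F} alt A = trans (Alternating.ext alt (λ ())) (sym (*-identityˡ (F δ)))
  det-unique {suc n} {F} alt A = begin
    F A
      ≡⟨ ext (λ { zero j → refl ; (suc i) j → refl }) ⟩
    F (set A zero (A zero))
      ≡⟨ expand-row A zero (A zero) ⟩
    sumFin (λ j → A zero j * F (set A zero (δ j)))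
      ≡⟨ sumFin-cong (λ j → cong (A zero j *_) (column j)) ⟩
    sumFin (λ j → A zero j * (det (minor A j) * (sign (toℕ j) * F δ)))
      ≡⟨ sumFin-cong (λ j → reorder (A zero j) (det (minor A j)) (sign (toℕ j)) (F δ)) ⟩
    sumFin (λ j → F δ * (sign (toℕ j) * A zero j * det (minor A j)))
      ≡⟨ sym (*-sumFin (F δ) (λ j → sign (toℕ j) * A zero j * det (minor A j))) ⟩
    F δ * det A
      ≡⟨ *-comm (F δ) (det A) ⟩
    det A * F δ ∎
    where
    open ≡-Reasoning
    open Alternating alt
    reorder : ∀ a d s f → a * (d * (s * f)) ≡ f * (s * a * d)
    reorder = solve-∀
    module _ (j : Fin (suc n)) where
      G : Matrix n n → ℤ
      G B = F (δ j ◂ insert0 j ∘ B)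
      module Altδ = Alternating (Alternating-◂ alt (δ j))
      insert-set : ∀ B i x → (λ t → insert0 j (set B i x t)) ≈ set (insert0 j ∘ B) i (insert0 j x)
      insert-set B i x t = cong-app (set-map (insert0 j) B i x t)
      altG : Alternating G
      altG = record
        { ext = λ eq → Altδ.ext (λ i → insert0-cong j (eq i))
        ; additive = λ B i x y → trans (Altδ.ext (insert-set B i _))
            (trans (Altδ.ext-row _ i (insert0-+ j x y))
            (trans (Altδ.additive _ i _ _)
              (sym (cong₂ _+_ (Altδ.ext (insert-set B i x)) (Altδ.ext (insert-set B i y))))))
        ; homogeneous = λ B i c x → trans (Altδ.ext (insert-set B i _))
            (trans (Altδ.ext-row _ i (insert0-* j c x))
            (trans (Altδ.homogeneous _ i c (insert0 j x)) (sym (cong (c *_) (Altδ.ext (insert-set B i x))))))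
        ; alternate = λ B i≢i' eq → Altδ.alternate _ i≢i' (insert0-cong j eq)
        }
      _∼_ : (Fin (suc n) → ℤ) → (Fin (suc n) → ℤ) → Set
      x ∼ y = ∃ λ c → ∀ k → x k ≡ y k + c * δ j k
      clear : ∀ B i {x y} → x ∼ y → F (δ j ◂ set B i x) ≡ F (δ j ◂ set B i y)
      clear B i {x} {y} (c , eq) = begin
        F (δ j ◂ set B i x)                                  ≡⟨ Altδ.ext-row B i eq ⟩
        F (δ j ◂ set B i (λ k → y k + c * δ j k))            ≡⟨ ext (λ { zero t → refl ; (suc u) t → refl }) ⟩
        F (set (δ j ◂ B) (suc i) (λ k → y k + c * δ j k))    ≡⟨ add-multiple (δ j ◂ B) {suc i} {zero} (λ ()) y c ⟩
        F (set (δ j ◂ B) (suc i) y)                          ≡⟨ ext (λ { zero t → refl ; (suc u) t → refl }) ⟩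
        F (δ j ◂ set B i y) ∎
      column : F (set A zero (δ j)) ≡ det (minor A j) * (sign (toℕ j) * F δ)
      column = begin
        F (set A zero (δ j))
          ≡⟨ ext (λ { zero t → refl ; (suc i) t → refl }) ⟩
        F (δ j ◂ A ∘ suc)
          ≡⟨ replace-rows {_∼_ = _∼_} (λ B → F (δ j ◂ B)) Altδ.ext clear _ _
               (λ i → A (suc i) j , insert0-punchIn j (A (suc i))) ⟩
        G (minor A j)
          ≡⟨ det-unique altG (minor A j) ⟩
        det (minor A j) * G δ
          -- `G δ` is `F` at the identity matrix with row `j` moved to the front, which is where the
          -- sign comes from.
          ≡⟨ cong (det (minor A j) *_) (trans (Altδ.ext (insert0-δ j)) (rotate-rows alt δ j)) ⟩
        det (minor A j) * (sign (toℕ j) * F δ) ∎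

  -- The expansion along the first row is alternating.

  sumFin-neg : (h : Fin n → ℤ) → sumFin (λ j → - h j) ≡ - sumFin h
  sumFin-neg h = trans (sumFin-cong (λ j → sym (-1*i≡-i (h j)))) (trans (sym (*-sumFin -1ℤ h)) (-1*i≡-i (sumFin h)))

  det-cong : ∀ {n} {A B : Matrix n n} → A ≈ B → det A ≡ det B
  det-cong {zero}  eq = refl
  det-cong {suc n} eq = sumFin-cong λ j →
    cong₂ (λ a d → sign (toℕ j) * a * d) (eq zero j) (det-cong (λ i' j' → eq (suc i') (punchIn j j')))

  -- Pairs of distinct columns (j , j') and (j' , j) contribute opposite terms.
  two-equal-rows-cancel : ∀ n (x : Fin (suc (suc n)) → ℤ) (E : (Fin n → Fin (suc (suc n))) → ℤ) →
    (∀ {φ ψ} → (∀ t → φ t ≡ ψ t) → E φ ≡ E ψ) →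
    sumFin (λ j → sign (toℕ j) * x j *
      sumFin (λ k → sign (toℕ k) * x (punchIn j k) * E (λ t → punchIn j (punchIn k t)))) ≡ 0ℤ
  two-equal-rows-cancel n x E ext = begin
    1ℤ * x zero * sumFin first + sumFin (λ j → s (suc j) * x (suc j) * (1ℤ * x zero * E₀ j + sumFin (rest j)))
      -- Pairs that use column `zero` occur twice, with the first or the second row there; the signs
      -- differ by one place, so they cancel. The pairs avoiding it form `inner`.
      ≡⟨ cong₂ _+_ (*-sumFin (1ℤ * x zero) first) (sumFin-cong λ j → split j) ⟩
    sumFin (λ k → 1ℤ * x zero * first k) + sumFin (λ j → - (1ℤ * x zero * first j) + inner j)
      ≡⟨ cong (sumFin (λ k → 1ℤ * x zero * first k) +_)
           (trans (sumFin-+ (λ j → - (1ℤ * x zero * first j)) inner)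
                  (cong (_+ sumFin inner) (sumFin-neg (λ j → 1ℤ * x zero * first j)))) ⟩
    sumFin (λ k → 1ℤ * x zero * first k) + (- sumFin (λ k → 1ℤ * x zero * first k) + sumFin inner)
      ≡⟨ cancel (sumFin (λ k → 1ℤ * x zero * first k)) (sumFin inner) ⟩
    sumFin inner
      ≡⟨ inner≡0 n x E ext ⟩
    0ℤ ∎
    where
    open ≡-Reasoning
    s : ∀ {n} → Fin n → ℤ
    s = sign ∘ toℕ
    E₀ : Fin (suc n) → ℤ
    E₀ k = E (λ t → suc (punchIn k t))
    first : Fin (suc n) → ℤ
    first k = s k * x (suc k) * E₀ k
    rest : Fin (suc n) → Fin n → ℤ
    rest j k = s (suc k) * x (suc (punchIn j k)) * E (λ t → punchIn (suc j) (punchIn (suc k) t))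
    inner : Fin (suc n) → ℤ
    inner j = s (suc j) * x (suc j) * sumFin (rest j)
    distribute : ∀ s a z e r → - s * a * (1ℤ * z * e + r) ≡ - (1ℤ * z * (s * a * e)) + - s * a * r
    distribute = solve-∀
    split : ∀ j → s (suc j) * x (suc j) * (1ℤ * x zero * E₀ j + sumFin (rest j))
      ≡ - (1ℤ * x zero * first j) + inner j
    split j rewrite sign-suc (toℕ j) = distribute (s j) (x (suc j)) (x zero) (E₀ j) (sumFin (rest j))
    cancel : ∀ a b → a + (- a + b) ≡ b
    cancel = solve-∀
    inner≡0 : ∀ n (x : Fin (suc (suc n)) → ℤ) (E : (Fin n → Fin (suc (suc n))) → ℤ) →
      (∀ {φ ψ} → (∀ t → φ t ≡ ψ t) → E φ ≡ E ψ) →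
      sumFin (λ j → s (suc j) * x (suc j) * sumFin (λ k → s (suc k) * x (suc (punchIn j k)) *
        E (λ t → punchIn (suc j) (punchIn (suc k) t)))) ≡ 0ℤ
    inner≡0 zero    x E ext = sumFin-zero (λ j → *-zeroʳ (s (suc j) * x (suc j)))
    inner≡0 (suc n) x E ext = trans (sumFin-cong two-signs) (two-equal-rows-cancel n (x ∘ suc) E′ ext′)
      where
      E′ : (Fin n → Fin (suc (suc n))) → ℤ
      E′ φ = E (zero ◂ suc ∘ φ)
      ext′ : ∀ {φ ψ} → (∀ t → φ t ≡ ψ t) → E′ φ ≡ E′ ψ
      ext′ eq = ext λ { zero → refl ; (suc t) → cong suc (eq t) }
      negate-both : ∀ s a b → - s * a * (- 1ℤ * b) ≡ s * a * b
      negate-both = solve-∀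
      neg-term : ∀ s a b → - s * a * b ≡ - 1ℤ * (s * a * b)
      neg-term = solve-∀
      term : ∀ j k → s (suc k) * x (suc (punchIn j k)) * E (λ t → punchIn (suc j) (punchIn (suc k) t))
        ≡ - 1ℤ * (s k * x (suc (punchIn j k)) * E′ (λ t → punchIn j (punchIn k t)))
      term j k = begin
        s (suc k) * x (suc (punchIn j k)) * E (λ t → punchIn (suc j) (punchIn (suc k) t))
          ≡⟨ cong₂ (λ a b → a * x (suc (punchIn j k)) * b) (sign-suc (toℕ k))
               (ext {ψ = zero ◂ suc ∘ (λ t → punchIn j (punchIn k t))} (λ { zero → refl ; (suc t) → refl })) ⟩
        - s k * x (suc (punchIn j k)) * E′ (λ t → punchIn j (punchIn k t))
          ≡⟨ neg-term (s k) (x (suc (punchIn j k))) (E′ (λ t → punchIn j (punchIn k t))) ⟩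
        - 1ℤ * (s k * x (suc (punchIn j k)) * E′ (λ t → punchIn j (punchIn k t))) ∎
      two-signs : ∀ j → s (suc j) * x (suc j) * sumFin (λ k → s (suc k) * x (suc (punchIn j k)) *
          E (λ t → punchIn (suc j) (punchIn (suc k) t)))
        ≡ s j * x (suc j) * sumFin (λ k → s k * x (suc (punchIn j k)) * E′ (λ t → punchIn j (punchIn k t)))
      two-signs j = begin
        s (suc j) * x (suc j) * _
          ≡⟨ cong₂ (λ a b → a * x (suc j) * b) (sign-suc (toℕ j))
               (trans (sumFin-cong (term j)) (sym (*-sumFin (- 1ℤ) summand))) ⟩
        - s j * x (suc j) * (- 1ℤ * sumFin summand)
          ≡⟨ negate-both (s j) (x (suc j)) (sumFin summand) ⟩
        s j * x (suc j) * sumFin summand ∎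
        where
        summand : Fin (suc n) → ℤ
        summand k = s k * x (suc (punchIn j k)) * E′ (λ t → punchIn j (punchIn k t))

  minor-set : ∀ (A : Matrix (suc n) (suc n)) i x j →
    minor (set A (suc i) x) j ≈ set (minor A j) i (x ∘ punchIn j)
  minor-set A i x j i' j' = cong-app (set-map (_∘ punchIn j) (A ∘ suc) i x i') j'

  alternating-step : Alternating (det {n}) → Alternating (det {suc n})
  alternating-step {n} ih = record
    { ext         = det-cong
    ; additive    = additive
    ; homogeneous = homogeneous
    ; alternate   = alternate
    }
    where
    module IH = Alternating ih
    minor-set-det : ∀ A i x j → det (minor (set A (suc i) x) j) ≡ det (set (minor A j) i (x ∘ punchIn j))
    minor-set-det A i x j = det-cong (minor-set A i x j)

    additive : ∀ A i x y → det (set A i (λ j → x j + y j)) ≡ det (set A i x) + det (set A i y)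
    additive A zero x y = trans
      (sumFin-cong (λ j → distrib (sign (toℕ j)) (x j) (y j) (det (minor A j))))
      (sumFin-+ (λ j → sign (toℕ j) * x j * det (minor A j)) (λ j → sign (toℕ j) * y j * det (minor A j)))
      where
      distrib : ∀ s a b d → s * (a + b) * d ≡ s * a * d + s * b * d
      distrib = solve-∀
    additive A (suc i) x y = trans
      (sumFin-cong (λ j → trans (cong (sign (toℕ j) * A zero j *_) (minor-sum j))
        (distrib (sign (toℕ j) * A zero j) (det (minor (set A (suc i) x) j)) (det (minor (set A (suc i) y) j)))))
      (sumFin-+ (λ j → sign (toℕ j) * A zero j * det (minor (set A (suc i) x) j))
                (λ j → sign (toℕ j) * A zero j * det (minor (set A (suc i) y) j)))
      where
      distrib : ∀ a b c → a * (b + c) ≡ a * b + a * c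
      distrib = solve-∀
      minor-sum : ∀ j → det (minor (set A (suc i) (λ j → x j + y j)) j)
        ≡ det (minor (set A (suc i) x) j) + det (minor (set A (suc i) y) j)
      minor-sum j = trans (minor-set-det A i _ j) (trans (IH.additive (minor A j) i _ _)
        (sym (cong₂ _+_ (minor-set-det A i x j) (minor-set-det A i y j))))

    homogeneous : ∀ A i c x → det (set A i (λ j → c * x j)) ≡ c * det (set A i x)
    homogeneous A zero c x = trans
      (sumFin-cong (λ j → pull (sign (toℕ j)) c (x j) (det (minor A j))))
      (sym (*-sumFin c (λ j → sign (toℕ j) * x j * det (minor A j))))
      where
      pull : ∀ s c a d → s * (c * a) * d ≡ c * (s * a * d)
      pull = solve-∀
    homogeneous A (suc i) c x = trans
      (sumFin-cong (λ j → trans (cong (sign (toℕ j) * A zero j *_) (minor-mult j))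
        (pull (sign (toℕ j) * A zero j) c (det (minor (set A (suc i) x) j)))))
      (sym (*-sumFin c (λ j → sign (toℕ j) * A zero j * det (minor (set A (suc i) x) j))))
      where
      pull : ∀ a c d → a * (c * d) ≡ c * (a * d)
      pull = solve-∀
      minor-mult : ∀ j → det (minor (set A (suc i) (λ j → c * x j)) j) ≡ c * det (minor (set A (suc i) x) j)
      minor-mult j = trans (minor-set-det A i _ j) (trans (IH.homogeneous (minor A j) i c (x ∘ punchIn j))
        (sym (cong (c *_) (minor-set-det A i x j))))

    first-two : ∀ {n} (A : Matrix (suc (suc n)) (suc (suc n))) → (∀ j → A zero j ≡ A (suc zero) j) → det A ≡ 0ℤ
    first-two {n} A eq = trans
      (det-cong {A = A} {B = A zero ◂ A zero ◂ λ i → A (suc (suc i))}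
        (λ { zero j → refl ; (suc zero) j → sym (eq j) ; (suc (suc i)) j → refl }))
      (two-equal-rows-cancel n (A zero) (λ φ → det (λ i j → A (suc (suc i)) (φ j)))
        (λ eq → det-cong (λ i j → cong (A (suc (suc i))) (eq j))))

    -- Exchanging the later row with row `suc zero` negates every minor, by the induction
    -- hypothesis. The equal rows then come first and second.
    first-and-later : ∀ A i → (∀ j → A zero j ≡ A (suc i) j) → det A ≡ 0ℤ
    first-and-later A zero    eq = first-two A eq
    first-and-later A (suc i) eq = begin
      det A    ≡⟨ sumFin-cong (λ j → trans (cong (sign (toℕ j) * A zero j *_) (minors j))
                    (negate (sign (toℕ j) * A zero j) (det (minor B j)))) ⟩
      sumFin (λ j → - (sign (toℕ j) * A zero j * det (minor B j)))
               ≡⟨ sumFin-neg (λ j → sign (toℕ j) * A zero j * det (minor B j)) ⟩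
      - det B  ≡⟨ cong -_ (first-two B eq) ⟩
      0ℤ ∎
      where
      open ≡-Reasoning
      B : Matrix _ _
      B = swapRows A (suc zero) (suc (suc i))
      negate : ∀ a b → a * - b ≡ - (a * b)
      negate = solve-∀
      swapped : ∀ j → swapRows (minor A j) zero (suc i) ≈ minor B j
      swapped j zero    j' = refl
      swapped j (suc t) j' = sym (cong-app
        (set-map (_∘ punchIn j) (λ u → A (suc (suc u))) i (A (suc zero)) t) j')
      minors : ∀ j → det (minor A j) ≡ - det (minor B j)
      minors j = trans (swap-rows ih (minor A j) {zero} {suc i} (λ ()))
        (cong -_ (det-cong (swapped j)))

    alternate : ∀ A {i i'} → i ≢ i' → (∀ j → A i j ≡ A i' j) → det A ≡ 0ℤ
    alternate A {zero}  {zero}   i≢i' eq = ⊥-elim (i≢i' refl)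
    alternate A {zero}  {suc i'} i≢i' eq = first-and-later A i' eq
    alternate A {suc i} {zero}   i≢i' eq = first-and-later A i (sym ∘ eq)
    alternate A {suc i} {suc i'} i≢i' eq = sumFin-zero λ j → trans
      (cong (sign (toℕ j) * A zero j *_) (IH.alternate (minor A j) (i≢i' ∘ cong suc) (eq ∘ punchIn j)))
      (*-zeroʳ (sign (toℕ j) * A zero j))

  det-alternating : ∀ n → Alternating (det {n})
  det-alternating zero = record
    { ext         = λ _ → refl
    ; additive    = λ A ()
    ; homogeneous = λ A ()
    ; alternate   = λ { A {()} }
    }
  det-alternating (suc n) = alternating-step (det-alternating n)

  -- Multiplicativity of the determinant.

  det-δ : ∀ n → det (δ {n}) ≡ 1ℤ
  det-δ zero    = refl
  det-δ (suc n) = cong₂ _+_ (trans (*-identityˡ (det (δ {n}))) (det-δ n))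
    (sumFin-zero {n} (λ j → cong (_* det (minor δ (suc j))) (*-zeroʳ (sign (toℕ (suc j))))))

  infixl 7 _⊗_
  _⊗_ : ∀ {k} → Matrix m k → Matrix k n → Matrix m n
  (A ⊗ B) i j = sumFin (λ t → A i t * B t j)

  ⊗-set : ∀ {k} (A : Matrix m k) i x (B : Matrix k n) → set A i x ⊗ B ≈ set (A ⊗ B) i (λ j → sumFin (λ t → x t * B t j))
  ⊗-set A i x B t j = cong-app (set-map (λ row j → sumFin (λ u → row u * B u j)) A i x t) j

  -- For fixed `B` the left side is alternating in the rows of `A`, hence determined by its value at
  -- `δ`.
  det-⊗ : (A B : Matrix n n) → det (A ⊗ B) ≡ det A * det B
  det-⊗ {n} A B = trans (det-unique alt A) (cong (det A *_) (det-cong δ⊗B))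
    where
    module D = Alternating (det-alternating n)
    δ⊗B : δ ⊗ B ≈ B
    δ⊗B i j = left i (λ t → B t j)
      where
      left : ∀ {n} i (h : Fin n → ℤ) → sumFin (λ t → δ i t * h t) ≡ h i
      left zero    h = trans (cong₂ _+_ (*-identityˡ (h zero)) (sumFin-zero (λ t → *-zeroˡ (h (suc t))))) (+-identityʳ (h zero))
      left (suc i) h = trans (cong₂ _+_ (*-zeroˡ (h zero)) (left i (h ∘ suc))) (+-identityˡ (h (suc i)))
    alt : Alternating (λ A → det (A ⊗ B))
    alt = record
      { ext         = λ eq → det-cong (λ i j → sumFin-cong (λ t → cong (_* B t j) (eq i t)))
      ; additive    = λ A i x y → trans (det-cong (⊗-set A i _ B))
          (trans (D.ext-row (A ⊗ B) i (λ j → trans (sumFin-cong (λ t → distrib (x t) (y t) (B t j)))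
                   (sumFin-+ (λ t → x t * B t j) (λ t → y t * B t j))))
          (trans (D.additive (A ⊗ B) i _ _)
          (sym (cong₂ _+_ (det-cong (⊗-set A i x B)) (det-cong (⊗-set A i y B))))))
      ; homogeneous = λ A i c x → trans (det-cong (⊗-set A i _ B))
          (trans (D.ext-row (A ⊗ B) i (λ j → trans (sumFin-cong (λ t → assoc c (x t) (B t j)))
                   (sym (*-sumFin c (λ t → x t * B t j)))))
          (trans (D.homogeneous (A ⊗ B) i c (λ j → sumFin (λ t → x t * B t j)))
          (sym (cong (c *_) (det-cong (⊗-set A i x B))))))
      ; alternate   = λ A i≢i' eq → D.alternate (A ⊗ B) i≢i'
          (λ j → sumFin-cong (λ t → cong (_* B t j) (eq t)))
      }
      where
      distrib : ∀ a b c → (a + b) * c ≡ a * c + b * c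
      distrib = solve-∀
      assoc : ∀ a b c → a * b * c ≡ a * (b * c)
      assoc = solve-∀

  -- Columns, Cramer's rule and the adjugate.

  prodFin : (Fin n → ℤ) → ℤ
  prodFin {zero}  h = 1ℤ
  prodFin {suc n} h = h zero * prodFin (h ∘ suc)

  prodFin-punchIn : ∀ (h : Fin (suc n) → ℤ) j → prodFin h ≡ h j * prodFin (h ∘ punchIn j)
  prodFin-punchIn h zero = refl
  prodFin-punchIn {suc n} h (suc j) = trans (cong (h zero *_) (prodFin-punchIn (h ∘ suc) j))
    (exchange (h zero) (h (suc j)) (prodFin (h ∘ suc ∘ punchIn j)))
    where
    exchange : ∀ a b c → a * (b * c) ≡ b * (a * c)
    exchange = solve-∀

  prodFin-one : ∀ (j : Fin n) m → prodFin (set (λ _ → 1ℤ) j m) ≡ m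
  prodFin-one {suc n} zero m = trans (cong (m *_) (ones n)) (*-identityʳ m)
    where
    ones : ∀ n → prodFin {n} (λ _ → 1ℤ) ≡ 1ℤ
    ones zero    = refl
    ones (suc n) = trans (*-identityˡ (prodFin {n} (λ _ → 1ℤ))) (ones n)
  prodFin-one (suc j) m = trans (*-identityˡ (prodFin (set (λ _ → 1ℤ) j m))) (prodFin-one j m)

  -- `Alternating` speaks of rows only, so columns are treated through the expansion: each of its
  -- terms uses every column once.
  det-scale-columns : ∀ {n} (s : Fin n → ℤ) A → det (λ i j → s j * A i j) ≡ prodFin s * det A
  det-scale-columns {zero}  s A = refl
  det-scale-columns {suc n} s A = trans
    (sumFin-cong (λ j → trans
      (cong (sign (toℕ j) * (s j * A zero j) *_) (det-scale-columns (s ∘ punchIn j) (minor A j)))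
      (trans (reorder (sign (toℕ j)) (s j) (A zero j) (prodFin (s ∘ punchIn j)) (det (minor A j)))
        (cong (_* (sign (toℕ j) * A zero j * det (minor A j))) (sym (prodFin-punchIn s j))))))
    (sym (*-sumFin (prodFin s) (λ j → sign (toℕ j) * A zero j * det (minor A j))))
    where
    reorder : ∀ σ s a p d → σ * (s * a) * (p * d) ≡ s * p * (σ * a * d)
    reorder = solve-∀

  det-scale-column : ∀ (A B : Matrix n n) j m → (∀ i → A i j ≡ m * B i j) →
    (∀ i {t} → t ≢ j → A i t ≡ B i t) → det A ≡ m * det B
  det-scale-column A B j m at off = trans (det-cong entry)
    (trans (det-scale-columns s B) (cong (_* det B) (prodFin-one j m)))
    where
    s : Fin _ → ℤ
    s = set (λ _ → 1ℤ) j m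
    entry : ∀ i t → A i t ≡ s t * B i t
    entry i t with t ≟ j
    ... | yes refl = trans (at i) (cong (_* B i t) (sym (set-≡ (λ _ → 1ℤ) t m)))
    ... | no t≢j   = trans (off i t≢j) (trans (sym (*-identityˡ (B i t))) (cong (_* B i t) (sym (set-≢ (λ _ → 1ℤ) j m t≢j))))

  -- A zero column equals `0ℤ` times itself, so the scalar `0ℤ` can be taken out.
  det-zero-column : ∀ (A : Matrix n n) j → (∀ i → A i j ≡ 0ℤ) → det A ≡ 0ℤ
  det-zero-column A j eq = trans (det-scale-column A A j 0ℤ (λ i → trans (eq i) (sym (*-zeroˡ (A i j)))) (λ _ _ → refl)) (*-zeroˡ (det A))

  column-identity : Fin n → (Fin n → ℤ) → Matrix n n
  column-identity j c i = set (δ i) j (c i)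

  det-column-identity : ∀ {n} (j : Fin n) c → det (column-identity j c) ≡ c j
  det-column-identity {suc n} zero c = trans
    (cong₂ _+_ (trans (cong (1ℤ * c zero *_) (det-δ n)) (ones (c zero)))
      (sumFin-zero (λ j → cong (_* det (minor (column-identity zero c) (suc j))) (*-zeroʳ (sign (toℕ (suc j)))))))
    (+-identityʳ (c zero))
    where
    ones : ∀ a → 1ℤ * a * 1ℤ ≡ a
    ones = solve-∀
  det-column-identity {suc n} (suc j) c = trans
    (cong₂ _+_ (trans (*-identityˡ (det (column-identity j (c ∘ suc)))) (det-column-identity j (c ∘ suc)))
      (sumFin-zero other))
    (+-identityʳ (c (suc j)))
    where
    other : ∀ t → sign (toℕ (suc t)) * column-identity (suc j) c zero (suc t)
        * det (minor (column-identity (suc j) c) (suc t)) ≡ 0ℤ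
    other t = trans (cong (sign (toℕ (suc t)) * column-identity (suc j) c zero (suc t) *_)
        (zero-first n (column-identity (suc j) c) t (λ _ → refl)))
      (*-zeroʳ (sign (toℕ (suc t)) * column-identity (suc j) c zero (suc t)))
      where
      zero-first : ∀ n (A : Matrix (suc n) (suc n)) t → (∀ i → A (suc i) zero ≡ 0ℤ) → det (minor A (suc t)) ≡ 0ℤ
      zero-first (suc n) A t eq = det-zero-column (minor A (suc t)) zero eq

  _·_ : Matrix m n → (Fin n → ℤ) → Fin m → ℤ
  (A · c) i = sumFin (λ t → A i t * c t)

  -- Replacing column `j` of `M` by `M · c` amounts to multiplying `M` by the identity whose column
  -- `j` is replaced by `c`. This form is free of division, so divisibility can be read from it.
  cramer : ∀ (M : Matrix n n) c j → det (λ i → set (M i) j ((M · c) i)) ≡ det M * c j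
  cramer M c j = trans (det-cong entry)
    (trans (det-⊗ M (column-identity j c)) (cong (det M *_) (det-column-identity j c)))
    where
    entry : (λ i → set (M i) j ((M · c) i)) ≈ M ⊗ column-identity j c
    entry i k with k ≟ j
    ... | yes refl = trans (set-≡ (M i) k _) (sumFin-cong (λ t → cong (M i t *_) (sym (set-≡ (δ t) k (c t)))))
    ... | no k≢j   = trans (set-≢ (M i) j _ k≢j) (trans (sym (sumFin-δʳ (M i) k))
      (sumFin-cong (λ t → cong (M i t *_) (sym (set-≢ (δ t) j (c t) k≢j)))))

  -- Overwriting row `i` with a unit row gives the cofactor at `(i , j)`; the indices are
  -- transposed.
  adjugate : Matrix n n → Matrix n n
  adjugate M j i = det (set M i (δ j))

  -- By `expand-row`, entry `(i , i')` is the determinant of `M` with row `i'` overwritten by row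
  -- `i`. Off the diagonal this has two equal rows.
  ⊗-adjugate : ∀ (M : Matrix n n) → M ⊗ adjugate M ≈ λ i j → det M * δ i j
  ⊗-adjugate {n} M i i' = trans (sym (expand-row M i' (M i))) entry
    where
    open Alternating (det-alternating n)
    δ-refl : ∀ {n} (i : Fin n) → δ i i ≡ 1ℤ
    δ-refl zero    = refl
    δ-refl (suc i) = δ-refl i
    δ-≢ : ∀ {n} {i j : Fin n} → i ≢ j → δ i j ≡ 0ℤ
    δ-≢ {i = zero}  {zero}  i≢j = ⊥-elim (i≢j refl)
    δ-≢ {i = zero}  {suc j} i≢j = refl
    δ-≢ {i = suc i} {zero}  i≢j = refl
    δ-≢ {i = suc i} {suc j} i≢j = δ-≢ (i≢j ∘ cong suc)
    entry : det (set M i' (M i)) ≡ det M * δ i i'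
    entry with i ≟ i'
    ... | yes refl = trans (det-cong (λ t → cong-app (set-id M i t)))
      (sym (trans (cong (det M *_) (δ-refl i)) (*-identityʳ (det M))))
    ... | no i≢i' = trans (alternate (set M i' (M i)) i≢i'
        (cong-app (trans (set-≢ M i' (M i) i≢i') (sym (set-≡ M i' (M i))))))
      (sym (trans (cong (det M *_) (δ-≢ i≢i')) (*-zeroʳ (det M))))

  det-* : ∀ {n} c (A : Matrix n n) → det (λ i j → c * A i j) ≡ c ^ n * det A
  det-* {n} c A = trans (det-scale-columns (λ _ → c) A) (cong (_* det A) (power n))
    where
    power : ∀ n → prodFin {n} (λ _ → c) ≡ c ^ n
    power zero    = refl
    power (suc n) = cong (c *_) (power n)

module CommonRoots where

  open Determinants
  open import Defs
  open import Data.Nat as ℕ using (ℕ; zero; suc; _<_; _≤_; z≤n; s≤s; s<s; s≤s⁻¹; z<s)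
  import Data.Nat.Properties as ℕ
  import Data.Nat.Divisibility as ℕ
  import Data.Nat.GCD as GCD
  open import Data.Nat.Coprimality as Coprimality using (Coprime; coprime-Bézout)
  open import Data.Nat.Primality using (Prime; euclidsLemma; prime⇒irreducible; prime⇒nonZero; prime⇒nonTrivial)
  open import Data.Integer as ℤ using (ℤ; 0ℤ; 1ℤ; _+_; _*_; -_; _-_; _^_)
  open import Data.Integer.Properties using (+-identityˡ; +-identityʳ; +-inverseˡ; +-inverseʳ; *-identityˡ; *-identityʳ; *-zeroʳ; *-zeroˡ; *-comm; *-cancelˡ-≡; abs-*; i*j≢0; pos-*)
  open import Data.Integer.Divisibility.Signed using (_∣_; divides; quotient; _∣?_; ∣ᵤ⇒∣; ∣⇒∣ᵤ; ∣-trans; m∣∣m∣; ∣m∣n⇒∣m+n; ∣m∣n⇒∣m-n; ∣m+n∣n⇒∣m; ∣m⇒∣-m; ∣n⇒∣m*n; ∣m⇒∣m*n; *-cancelʳ-∣)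
  open import Data.Integer.Tactic.RingSolver using (solve-∀)
  open import Data.Fin using (Fin; zero; suc; toℕ; fromℕ<)
  open import Data.Fin.Properties using (_≟_; any?; toℕ<n; toℕ-fromℕ<)
  open import Data.List using (List; []; _∷_; length)
  open import Data.Vec using ([]; _∷_; toList; tail)
  open import Data.Vec.Properties using (length-toList)
  open import Data.Product using (_×_; ∃; ∃₂; _,_; proj₁; proj₂)
  open import Data.Sum using (_⊎_; inj₁; inj₂; [_,_]′)
  open import Data.Empty using (⊥-elim)
  open import Function using (_∘_; id)
  open import Relation.Nullary using (yes; no; ¬_; ¬?)
  open import Relation.Nullary.Decidable using (decidable-stable)
  open import Relation.Binary.PropositionalEquality

  private variable
    k l m n : ℕ

  -- Determinants and kernel vectors modulo an integer.

  prime≢1 : ∀ {p} → Prime p → p ≢ 1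
  prime≢1 pr = ℕ.nonTrivial⇒≢1 ⦃ prime⇒nonTrivial pr ⦄

  ∤⇒coprime : ∀ {p n} → Prime p → ¬ p ℕ.∣ n → Coprime n p
  ∤⇒coprime pr p∤n (d∣n , d∣p) with prime⇒irreducible pr d∣p
  ... | inj₁ d≡1  = d≡1
  ... | inj₂ refl = ⊥-elim (p∤n d∣n)

  ∣-respʳ : ∀ {d a b} → a ≡ b → d ∣ a → d ∣ b
  ∣-respʳ refl d = d

  divide-column : ∀ (A : Matrix n n) j {d} (d∣ : ∀ i → d ∣ A i j) →
    det A ≡ d * det (λ i → set (A i) j (quotient (d∣ i)))
  divide-column A j {d} d∣ = det-scale-column A _ j d
    (λ i → trans (trans (_∣_.equality (d∣ i)) (*-comm (quotient (d∣ i)) d)) (cong (d *_) (sym (set-≡ (A i) j (quotient (d∣ i))))))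
    (λ i t≢j → sym (set-≢ (A i) j (quotient (d∣ i)) t≢j))

  ∣-column⇒∣det : ∀ (A : Matrix n n) j {d} → (∀ i → d ∣ A i j) → d ∣ det A
  ∣-column⇒∣det A j {d} d∣ = divides (det B) (trans (divide-column A j d∣) (*-comm d (det B)))
    where
    B : Matrix _ _
    B i = set (A i) j (quotient (d∣ i))

  -- Dividing column `i` by `d` leaves column `j` as it was, so a second factor `d` can be
  -- extracted.
  ∣-columns⇒∣det : ∀ (A : Matrix n n) {i j d} → i ≢ j → (∀ u → d ∣ A u i) → (∀ u → d ∣ A u j) → d * d ∣ det A
  ∣-columns⇒∣det A {i} {j} {d} i≢j d∣i d∣j
    with divides q eq ← ∣-column⇒∣det (λ u → set (A u) i (quotient (d∣i u))) j
      (λ u → ∣-respʳ (sym (set-≢ (A u) i (quotient (d∣i u)) (i≢j ∘ sym))) (d∣j u))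
    = divides q (trans (divide-column A i d∣i) (trans (cong (d *_) eq) (reorder d q)))
    where
    reorder : ∀ d q → d * (q * d) ≡ q * (d * d)
    reorder = solve-∀

  Kernel : ℤ → Matrix m n → (Fin n → ℤ) → Set
  Kernel d M c = ∀ i → d ∣ (M · c) i

  -- The column that Cramer's rule inserts is `M · c`, divisible by `d`. A kernel vector with an
  -- entry `1` therefore forces `d ∣ det M`.
  kernel⇒∣det : ∀ {d} (M : Matrix n n) c → Kernel d M c → ∀ j → d ∣ det M * c j
  kernel⇒∣det M c ker j = ∣-respʳ (cramer M c j)
    (∣-column⇒∣det (λ i → set (M i) j ((M · c) i)) j (λ i → ∣-respʳ (sym (set-≡ (M i) j ((M · c) i))) (ker i)))

  -- Replace column i by M c, then column j by M (c i · c' - c' i · c).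
  kernel-pair⇒∣det : ∀ {d} (M : Matrix n n) c c' → Kernel d M c → Kernel d M c' → ∀ {i j} → i ≢ j →
    d * d ∣ det M * c i * (c i * c' j - c' i * c j)
  kernel-pair⇒∣det {n} {d} M c c' ker ker' {i} {j} i≢j = ∣-respʳ
    (trans (cramer M₁ c″ j) (cong (_* c″ j) (cramer M c i)))
    (∣-columns⇒∣det M₂ i≢j
      (λ u → ∣-respʳ (sym (trans (set-≢ (M₁ u) j ((M₁ · c″) u) i≢j) (set-≡ (M u) i ((M · c) u)))) (ker u))
      (λ u → ∣-respʳ (sym (set-≡ (M₁ u) j ((M₁ · c″) u))) (kernel″ u)))
    where
    c″ : Fin n → ℤ
    c″ t = c i * c' t - c' i * c t
    M₁ M₂ : Matrix n n
    M₁ u = set (M u) i ((M · c) u)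
    M₂ u = set (M₁ u) j ((M₁ · c″) u)
    -- Since this entry vanishes, the replaced column of `M₁` does not contribute and `M₁ · c″`
    -- equals `M · c″`.
    c″i≡0 : c″ i ≡ 0ℤ
    c″i≡0 = trans (cong (λ z → c i * c' i - z) (*-comm (c' i) (c i))) (+-inverseʳ (c i * c' i))
    term : ∀ u t → M₁ u t * c″ t ≡ M u t * c″ t
    term u t with t ≟ i
    ... | yes refl rewrite c″i≡0 = trans (*-zeroʳ (M₁ u t)) (sym (*-zeroʳ (M u t)))
    ... | no t≢i = cong (_* c″ t) (set-≢ (M u) i ((M · c) u) t≢i)
    expand : ∀ a x y s t → s * (a * x - t * y) ≡ a * (s * x) + - t * (s * y)
    expand = solve-∀
    split : ∀ u → (M₁ · c″) u ≡ c i * (M · c') u + - c' i * (M · c) u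
    split u = trans (sumFin-cong (term u)) (trans (sumFin-cong (λ t → expand (c i) (c' t) (c t) (M u t) (c' i)))
      (trans (sumFin-+ (λ t → c i * (M u t * c' t)) (λ t → - c' i * (M u t * c t)))
        (sym (cong₂ _+_ (*-sumFin (c i) (λ t → M u t * c' t)) (*-sumFin (- c' i) (λ t → M u t * c t))))))
    kernel″ : ∀ u → d ∣ (M₁ · c″) u
    kernel″ u = ∣-respʳ (sym (split u)) (∣m∣n⇒∣m+n (∣n⇒∣m*n (c i) (ker' u)) (∣n⇒∣m*n (- c' i) (ker u)))

  -- Kernel modulo a prime that divides the determinant exactly once.

  module ModPrime {p : ℕ} (pr : Prime p) where
    P : ℤ
    P = ℤ.+ p

    instance
      P≢0 : ℤ.NonZero P
      P≢0 = prime⇒nonZero pr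

    P∤1 : ¬ P ∣ 1ℤ
    P∤1 P∣1 = prime≢1 pr (ℕ.∣1⇒≡1 (∣⇒∣ᵤ P∣1))

    P∣* : ∀ a b → P ∣ a * b → P ∣ a ⊎ P ∣ b
    P∣* a b P∣ab with euclidsLemma ℤ.∣ a ∣ ℤ.∣ b ∣ pr (subst (p ℕ.∣_) (abs-* a b) (∣⇒∣ᵤ P∣ab))
    ... | inj₁ p∣a = inj₁ (∣ᵤ⇒∣ p∣a)
    ... | inj₂ p∣b = inj₂ (∣ᵤ⇒∣ p∣b)

    P∣^ : ∀ a k → P ∣ a ^ k → P ∣ a
    P∣^ a zero    P∣1 = ⊥-elim (P∤1 P∣1)
    P∣^ a (suc k) P∣a = [ id , P∣^ a k ]′ (P∣* a (a ^ k) P∣a)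

    P^≢0 : ∀ k → ℤ.NonZero (P ^ k)
    P^≢0 zero    = _
    P^≢0 (suc k) = i*j≢0 P (P ^ k) ⦃ P≢0 ⦄ ⦃ P^≢0 k ⦄

    module _ (M : Matrix n n) (P∣det : P ∣ det M) (P²∤det : ¬ P * P ∣ det M) where
      private
        s : ℤ
        s = quotient P∣det
        det≡sP : det M ≡ s * P
        det≡sP = _∣_.equality P∣det
        P∤s : ¬ P ∣ s
        P∤s (divides q eq) = P²∤det (divides q (trans det≡sP (trans (cong (_* P) eq) (assoc q P))))
          where
          assoc : ∀ a b → a * b * b ≡ a * (b * b)
          assoc = solve-∀

      -- Otherwise M ⊗ adjugate M = det M · I, of determinant (s P)ⁿ, gives P ∣ sⁿ.
      adjugate-nonzero : ∃₂ λ j i → ¬ P ∣ adjugate M j i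
      adjugate-nonzero with any? (λ j → any? (λ i → ¬? (P ∣? adjugate M j i)))
      ... | yes found = found
      ... | no  none  = ⊥-elim (P∤s (P∣^ s n (divides (s * det q) (sym s^n≡))))
        where
        P∣adj : ∀ j i → P ∣ adjugate M j i
        P∣adj j i = decidable-stable (P ∣? _) (λ ∤ → none (j , i , ∤))
        q : Matrix n n
        q j i = quotient (P∣adj j i)
        det-adj : det (adjugate M) ≡ P ^ n * det q
        det-adj = trans (det-cong (λ j i → trans (_∣_.equality (P∣adj j i)) (*-comm (q j i) P))) (det-* P q)
        ^-distrib : ∀ a b k → (a * b) ^ k ≡ b ^ k * a ^ k
        ^-distrib a b zero    = refl
        ^-distrib a b (suc k) = trans (cong (a * b *_) (^-distrib a b k)) (exchange a b (b ^ k) (a ^ k))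
          where
          exchange : ∀ a b c d → a * b * (c * d) ≡ b * c * (a * d)
          exchange = solve-∀
        product : P ^ n * (s * det q * P) ≡ P ^ n * s ^ n
        product = begin
          P ^ n * (s * det q * P)               ≡⟨ reorder (P ^ n) s (det q) P ⟩
          s * P * (P ^ n * det q)               ≡⟨ cong₂ _*_ (sym det≡sP) (sym det-adj) ⟩
          det M * det (adjugate M)              ≡⟨ sym (det-⊗ M (adjugate M)) ⟩
          det (M ⊗ adjugate M)                  ≡⟨ det-cong (⊗-adjugate M) ⟩
          det {n} (λ i j → det M * δ i j)       ≡⟨ det-* {n} (det M) δ ⟩
          det M ^ n * det (δ {n})               ≡⟨ cong₂ (λ a b → a ^ n * b) det≡sP (det-δ n) ⟩
          (s * P) ^ n * 1ℤ                      ≡⟨ *-identityʳ ((s * P) ^ n) ⟩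
          (s * P) ^ n                           ≡⟨ ^-distrib s P n ⟩
          P ^ n * s ^ n                         ∎
          where
          open ≡-Reasoning
          reorder : ∀ a s d p → a * (s * d * p) ≡ s * p * (a * d)
          reorder = solve-∀
        s^n≡ : s * det q * P ≡ s ^ n
        s^n≡ = *-cancelˡ-≡ (P ^ n) _ _ ⦃ P^≢0 n ⦄ product

      -- Each column of the adjugate is mapped by `M` to a multiple of `det M`, hence of `P`.
      kernel-exists : ∃ λ c → Kernel P M c × ∃ λ j → ¬ P ∣ c j
      kernel-exists with j , i , P∤ ← adjugate-nonzero =
        (λ t → adjugate M t i) , (λ u → ∣-respʳ (sym (⊗-adjugate M u i)) (∣m⇒∣m*n (δ u i) P∣det)) , j , P∤

      -- Proportionality in cross-multiplied form. `P * P` divides `det M * c i` times the cross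
      -- difference, `det M` supplies a single factor `P` and `c i` none, so the difference must
      -- supply the other.
      kernel-unique : ∀ c c' → Kernel P M c → Kernel P M c' → ∀ i → ¬ P ∣ c i → ∀ j → P ∣ c i * c' j - c' i * c j
      kernel-unique c c' ker ker' i P∤ci j with i ≟ j
      ... | yes refl = divides 0ℤ (trans (cong (λ z → c i * c' i - z) (*-comm (c' i) (c i)))
                         (trans (+-inverseʳ (c i * c' i)) (sym (*-zeroˡ P))))
      ... | no i≢j = [ (λ P∣s·ci → ⊥-elim ([ P∤s , P∤ci ]′ (P∣* s (c i) P∣s·ci))) , id ]′ (P∣* (s * c i) y P∣s·ci·y)
        where
        y : ℤ
        y = c i * c' j - c' i * c j
        reorder : ∀ s p c y → s * p * c * y ≡ s * c * y * p
        reorder = solve-∀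
        P∣s·ci·y : P ∣ s * c i * y
        P∣s·ci·y = *-cancelʳ-∣ P (∣-respʳ (trans (cong (λ z → z * c i * y) det≡sP) (reorder s P (c i) y))
          (kernel-pair⇒∣det M c c' ker ker' i≢j))

  -- Polynomials paired with linear functionals.

  ≡⇒∣- : ∀ {d a b} → a ≡ b → d ∣ a - b
  ≡⇒∣- {d} {a} refl = divides 0ℤ (trans (+-inverseʳ a) (sym (*-zeroˡ d)))

  -- Coefficients run from the leading one down, so `e` lists the values of a functional at
  -- descending powers of x, and `dot` is its value at the polynomial.
  dot : List ℤ → (ℕ → ℤ) → ℤ
  dot []       e = 0ℤ
  dot (a ∷ as) e = a * e 0 + dot as (e ∘ suc)

  dot-cong : ∀ as {e e'} → (∀ t → e t ≡ e' t) → dot as e ≡ dot as e'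
  dot-cong []       eq = refl
  dot-cong (a ∷ as) eq = cong₂ _+_ (cong (a *_) (eq 0)) (dot-cong as (eq ∘ suc))

  dot-zero : ∀ as → dot as (λ _ → 0ℤ) ≡ 0ℤ
  dot-zero []       = refl
  dot-zero (a ∷ as) = cong₂ _+_ (*-zeroʳ a) (dot-zero as)

  dot-linear : ∀ as c u v → dot as (λ t → c * u t + v t) ≡ c * dot as u + dot as v
  dot-linear []       c u v = sym (trans (+-identityʳ (c * 0ℤ)) (*-zeroʳ c))
  dot-linear (a ∷ as) c u v = trans (cong (λ z → a * (c * u 0 + v 0) + z) (dot-linear as c (u ∘ suc) (v ∘ suc)))
    (regroup a c (u 0) (v 0) (dot as (u ∘ suc)) (dot as (v ∘ suc)))
    where
    regroup : ∀ a c u v x y → a * (c * u + v) + (c * x + y) ≡ c * (a * u + x) + (a * v + y)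
    regroup = solve-∀

  dot-swap : ∀ as bs (E : ℕ → ℕ → ℤ) → dot as (λ t → dot bs (E t)) ≡ dot bs (λ s → dot as (λ t → E t s))
  dot-swap []       bs E = sym (dot-zero bs)
  dot-swap (a ∷ as) bs E = trans (cong (λ z → a * dot bs (E 0) + z) (dot-swap as bs (E ∘ suc)))
    (sym (dot-linear bs a (E 0) (λ s → dot as (λ t → E (suc t) s))))

  ∣-dot : ∀ {d} as {e} → (∀ t → t < length as → d ∣ e t) → d ∣ dot as e
  ∣-dot {d} []       ds = divides 0ℤ (sym (*-zeroˡ d))
  ∣-dot (a ∷ as) ds = ∣m∣n⇒∣m+n (∣n⇒∣m*n a (ds 0 z<s)) (∣-dot as (λ t t< → ds (suc t) (s<s t<)))

  -- Horner's scheme against a sequence that is geometric mod `d`: `acc * e 0` agrees with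
  -- `acc * x * e 1`, which merges with the next coefficient into the new accumulator.
  dot-evalList : ∀ {d} cs acc x e → (∀ t → t < length cs → d ∣ e t - x * e (suc t)) →
    d ∣ (acc * e 0 + dot cs (e ∘ suc)) - evalList acc x cs * e (length cs)
  dot-evalList []       acc x e geo = ≡⇒∣- (+-identityʳ (acc * e 0))
  dot-evalList (c ∷ cs) acc x e geo = ∣-respʳ
    (trans (cong (λ z → acc * (e 0 - x * e 1) + (z - v)) (expand acc x c (e 1) r))
      (regroup acc (e 0) (x * e 1) (c * e 1 + r) v))
    (∣m∣n⇒∣m+n (∣n⇒∣m*n acc (geo 0 z<s))
      (dot-evalList cs (acc * x + c) x (e ∘ suc) (λ t t< → geo (suc t) (s<s t<))))
    where
    r v : ℤ
    r = dot cs (λ t → e (suc (suc t)))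
    v = evalList (acc * x + c) x cs * e (suc (length cs))
    expand : ∀ a x c y r → (a * x + c) * y + r ≡ a * (x * y) + (c * y + r)
    expand = solve-∀
    regroup : ∀ a b y s v → a * (b - y) + ((a * y + s) - v) ≡ (a * b + s) - v
    regroup = solve-∀

  -- A functional whose successive values have ratio `x` is evaluation at `x`, scaled by its value
  -- `e k` at the constant `1`.
  dot-eval : ∀ {d} (f : Poly k) x e → (∀ t → t < k → d ∣ e t - x * e (suc t)) →
    d ∣ dot (toList f) e - eval f x * e k
  dot-eval {k} {d} (a ∷ v) x e geo = subst₂ (λ m b → d ∣ dot (a ∷ toList v) e - evalList b x (toList v) * e m)
    (length-toList v) (sym (+-identityˡ a))
    (dot-evalList (toList v) a x e (λ t t< → geo t (subst (t <_) (length-toList v) t<)))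

  dot-monic : ∀ (f : Poly k) → Monic f → ∀ e → dot (toList f) e ≡ e 0 + dot (toList (tail f)) (e ∘ suc)
  dot-monic (a ∷ v) refl e = cong (λ z → z + dot (toList v) (e ∘ suc)) (*-identityˡ (e 0))

  shifted-suc : ∀ (f : Poly k) s j → shifted f (suc s) (suc j) ≡ shifted f s j
  shifted-suc f s j with suc s ℕ.≤? suc j | s ℕ.≤? j
  ... | yes _       | yes _   = refl
  ... | yes (s≤s p) | no s≰j  = ⊥-elim (s≰j p)
  ... | no s≰j      | yes s≤j = ⊥-elim (s≰j (s≤s s≤j))
  ... | no _        | no _    = refl

  sumFin-coeffList : ∀ N as e → length as ≤ N → sumFin {N} (λ j → coeffList as (toℕ j) * e (toℕ j)) ≡ dot as e
  sumFin-coeffList N       []       e le       = sumFin-zero {N} (λ j → *-zeroˡ (e (toℕ j)))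
  sumFin-coeffList (suc N) (a ∷ as) e (s≤s le) = cong (λ z → a * e 0 + z) (sumFin-coeffList N as (e ∘ suc) le)

  sumFin-shifted : ∀ N (f : Poly k) s (e : ℕ → ℤ) → s ℕ.+ suc k ≤ N →
    sumFin {N} (λ j → shifted f s (toℕ j) * e (toℕ j)) ≡ dot (toList f) (λ t → e (s ℕ.+ t))
  sumFin-shifted N f zero e le = sumFin-coeffList N (toList f) e (subst (_≤ N) (sym (length-toList f)) le)
  sumFin-shifted (suc N) f (suc s) e (s≤s le) = trans (+-identityˡ (sumFin {N} (λ j → shifted f (suc s) (suc (toℕ j)) * e (suc (toℕ j)))))
    (trans (sumFin-cong {N} (λ j → cong (_* e (suc (toℕ j))) (shifted-suc f s (toℕ j)))) (sumFin-shifted N f s (e ∘ suc) le))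

  -- The Sylvester matrix acting on functionals.

  module _ (f : Poly k) (g : Poly l) where

    -- Row `i` holds the coefficients of x^(l - 1 - i) f, so the functional is read from index `i`
    -- on.
    upper-row : ∀ e i → toℕ i < l → (sylvester f g · (e ∘ toℕ)) i ≡ dot (toList f) (λ t → e (toℕ i ℕ.+ t))
    upper-row e i i<l = trans (sumFin-cong (λ j → cong (_* e (toℕ j)) (entry j)))
      (sumFin-shifted (k ℕ.+ l) f (toℕ i) e bound)
      where
      entry : ∀ j → sylvester f g i j ≡ shifted f (toℕ i) (toℕ j)
      entry j with toℕ i ℕ.<? l
      ... | yes _  = refl
      ... | no i≮l = ⊥-elim (i≮l i<l)
      bound : toℕ i ℕ.+ suc k ≤ k ℕ.+ l
      bound = subst₂ _≤_ (sym (ℕ.+-suc (toℕ i) k)) (ℕ.+-comm l k) (ℕ.+-monoˡ-≤ k i<l)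

    lower-row : ∀ e i → l ≤ toℕ i → (sylvester f g · (e ∘ toℕ)) i ≡ dot (toList g) (λ t → e (toℕ i ℕ.∸ l ℕ.+ t))
    lower-row e i l≤i = trans (sumFin-cong (λ j → cong (_* e (toℕ j)) (entry j)))
      (sumFin-shifted (k ℕ.+ l) g (toℕ i ℕ.∸ l) e bound)
      where
      entry : ∀ j → sylvester f g i j ≡ shifted g (toℕ i ℕ.∸ l) (toℕ j)
      entry j with toℕ i ℕ.<? l
      ... | yes i<l = ⊥-elim (ℕ.<⇒≱ i<l l≤i)
      ... | no _    = refl
      bound : toℕ i ℕ.∸ l ℕ.+ suc l ≤ k ℕ.+ l
      bound = subst (_≤ k ℕ.+ l) (sym (trans (ℕ.+-suc (toℕ i ℕ.∸ l) l) (cong suc (ℕ.m∸n+n≡m l≤i)))) (toℕ<n i)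

    -- Kernel vectors rewritten as sequences on `ℕ`, so that multiplication by x becomes a shift of
    -- the index. Only the first `k + l` entries are read.
    Annihilates : ℤ → (ℕ → ℤ) → Set
    Annihilates d e = (∀ i → i < l → d ∣ dot (toList f) (λ t → e (i ℕ.+ t)))
                    × (∀ i → i < k → d ∣ dot (toList g) (λ t → e (i ℕ.+ t)))

    annihilates⇒kernel : ∀ {d} e → Annihilates d e → Kernel d (sylvester f g) (e ∘ toℕ)
    annihilates⇒kernel e (annF , annG) i with ℕ.<-≤-connex (toℕ i) l
    ... | inj₁ i<l = ∣-respʳ (sym (upper-row e i i<l)) (annF (toℕ i) i<l)
    ... | inj₂ l≤i = ∣-respʳ (sym (lower-row e i l≤i)) (annG (toℕ i ℕ.∸ l)
            (ℕ.+-cancelʳ-< l _ _ (subst (_< k ℕ.+ l) (sym (ℕ.m∸n+n≡m l≤i)) (toℕ<n i))))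

    kernel⇒annihilates : ∀ {d} e → Kernel d (sylvester f g) (e ∘ toℕ) → Annihilates d e
    kernel⇒annihilates {d} e ker = annF , annG
      where
      annF : ∀ i → i < l → d ∣ dot (toList f) (λ t → e (i ℕ.+ t))
      annF i i<l = ∣-respʳ
        (trans (upper-row e u (subst (_< l) (sym u≡i) i<l)) (cong (λ i → dot (toList f) (λ t → e (i ℕ.+ t))) u≡i))
        (ker u)
        where
        u : Fin (k ℕ.+ l)
        u = fromℕ< (ℕ.<-≤-trans i<l (ℕ.m≤n+m l k))
        u≡i : toℕ u ≡ i
        u≡i = toℕ-fromℕ< _
      annG : ∀ i → i < k → d ∣ dot (toList g) (λ t → e (i ℕ.+ t))
      annG i i<k = ∣-respʳ
        (trans (lower-row e u (subst (l ≤_) (sym u≡i+l) (ℕ.m≤n+m l i)))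
          (cong (λ i → dot (toList g) (λ t → e (i ℕ.+ t))) (trans (cong (ℕ._∸ l) u≡i+l) (ℕ.m+n∸n≡m i l))))
        (ker u)
        where
        u : Fin (k ℕ.+ l)
        u = fromℕ< (ℕ.+-monoˡ-< l i<k)
        u≡i+l : toℕ u ≡ i ℕ.+ l
        u≡i+l = toℕ-fromℕ< _

  -- Evaluation functionals, and common divisors of values.

  eval-constant : ∀ (f : Poly 0) x → Monic f → eval f x ≡ 1ℤ
  eval-constant (a ∷ []) x refl = refl

  eval-cong-∣ : ∀ {d} (f : Poly k) x y → d ∣ x - y → d ∣ eval f x - eval f y
  eval-cong-∣ {d = d} f x y d∣ = go (toList f) 0ℤ 0ℤ (≡⇒∣- {a = 0ℤ} refl)
    where
    regroup : ∀ a a' x y c → (a - a') * x + a' * (x - y) ≡ (a * x + c) - (a' * y + c)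
    regroup = solve-∀
    go : ∀ cs a a' → d ∣ a - a' → d ∣ evalList a x cs - evalList a' y cs
    go []       a a' d∣' = d∣'
    go (c ∷ cs) a a' d∣' = go cs _ _ (∣-respʳ (regroup a a' x y c) (∣m∣n⇒∣m+n (∣m⇒∣m*n x d∣') (∣n⇒∣m*n a' d∣)))

  module _ (f : Poly k) (g : Poly l) (x : ℤ) (N' : ℕ) (N≡ : k ℕ.+ l ≡ suc N') where

    -- Evaluation at `x` as a functional. The top degree is `N'`, one less than the size of the
    -- matrix, so the last entry is `x ^ 0`.
    powers : ℕ → ℤ
    powers t = x ^ (N' ℕ.∸ t)

    -- By `dot-eval`, each row pairs with the powers to `eval f x` or `eval g x` times a power of
    -- `x`.
    powers-annihilate : ∀ {d} → d ∣ eval f x → d ∣ eval g x → Annihilates f g d powers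
    powers-annihilate {d} d∣f d∣g =
        (λ i i<l → ∣-dot-row f i (s≤s⁻¹ (subst₂ _≤_ refl N≡ (subst (_≤ k ℕ.+ l) (ℕ.+-comm k (suc i)) (ℕ.+-monoʳ-≤ k i<l)))) d∣f)
      , (λ i i<k → ∣-dot-row g i (s≤s⁻¹ (subst₂ _≤_ refl N≡ (ℕ.+-monoˡ-≤ l i<k))) d∣g)
      where
      step : ∀ t → t < N' → powers t ≡ x * powers (suc t)
      step t t<N' = trans (cong (x ^_) (sym (ℕ.suc-pred (N' ℕ.∸ t) ⦃ ℕ.>-nonZero (ℕ.m<n⇒0<n∸m t<N') ⦄)))
        (cong (λ z → x * x ^ z) (ℕ.pred[m∸n]≡m∸[1+n] N' t))
      ∣-dot-row : ∀ {k} (f : Poly k) i → i ℕ.+ k ≤ N' → d ∣ eval f x → d ∣ dot (toList f) (λ t → powers (i ℕ.+ t))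
      ∣-dot-row {k} f i i+k≤N' d∣f = ∣m+n∣n⇒∣m
        (dot-eval f x (λ t → powers (i ℕ.+ t)) (λ t t<k → ≡⇒∣- (trans
          (step (i ℕ.+ t) (ℕ.<-≤-trans (ℕ.+-monoʳ-< i t<k) i+k≤N'))
          (cong (λ z → x * powers z) (sym (ℕ.+-suc i t))))))
        (∣m⇒∣-m (∣m⇒∣m*n (powers (i ℕ.+ k)) d∣f))

  -- The kernel vector of powers of `x` ends in `1`, so Cramer's rule at the last column yields the
  -- resultant itself. For `k` zero the matrix may be empty, but then `f` is the constant `1`.
  common-divisor∣resultant : ∀ (f : Poly k) (g : Poly l) → Monic f → ∀ {d} x →
    d ∣ eval f x → d ∣ eval g x → d ∣ resultant f g
  common-divisor∣resultant {zero} f g monic {d} x d∣f d∣g =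
    ∣-trans (∣-respʳ (eval-constant f x monic) d∣f) (divides (resultant f g) (sym (*-identityʳ (resultant f g))))
  common-divisor∣resultant {suc k} {l} f g monic {d} x d∣f d∣g = ∣-respʳ last-entry
    (kernel⇒∣det (sylvester f g) (e ∘ toℕ) (annihilates⇒kernel f g e (powers-annihilate f g x (k ℕ.+ l) refl d∣f d∣g)) last)
    where
    e : ℕ → ℤ
    e = powers f g x (k ℕ.+ l) refl
    last : Fin (suc k ℕ.+ l)
    last = fromℕ< (ℕ.n<1+n (k ℕ.+ l))
    last-entry : resultant f g * e (toℕ last) ≡ resultant f g
    last-entry = trans (cong (λ t → resultant f g * x ^ t)
        (trans (cong (k ℕ.+ l ℕ.∸_) (toℕ-fromℕ< (ℕ.n<1+n (k ℕ.+ l)))) (ℕ.n∸n≡0 (k ℕ.+ l))))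
      (*-identityʳ (resultant f g))

  -- Existence and uniqueness of the common root modulo a prime.

  extend : (Fin n → ℤ) → ℕ → ℤ
  extend {zero}  c t       = 0ℤ
  extend {suc n} c zero    = c zero
  extend {suc n} c (suc t) = extend (c ∘ suc) t

  extend-toℕ : ∀ (c : Fin n → ℤ) j → extend c (toℕ j) ≡ c j
  extend-toℕ c zero    = refl
  extend-toℕ c (suc j) = extend-toℕ (c ∘ suc) j

  module CommonRoot {p : ℕ} (pr : Prime p) where
    open ModPrime pr

    inverse : ∀ w → ¬ P ∣ w → ∃ λ u → P ∣ u * w - 1ℤ
    inverse w P∤w with coprime-Bézout (Coprimality.sym (∤⇒coprime pr (P∤w ∘ ∣ᵤ⇒∣)))
    -- Bézout is applied to the absolute value of `w`, and `s` is the factor with `s * w` equal to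
    -- it.
    ... | GCD.Bézout.Identity.+- a b eq with divides s w≡ ← m∣∣m∣ {w} =
      - (ℤ.+ b) * s , divides (- (ℤ.+ a)) (lemma (ℤ.+ a) (ℤ.+ b) s w P
        (trans (trans (cong (λ z → 1ℤ + ℤ.+ b * z) (sym w≡)) (cong (1ℤ +_) (sym (pos-* b ℤ.∣ w ∣))))
          (trans (cong ℤ.+_ eq) (pos-* a p))))
      where
      lemma : ∀ a b s w p → 1ℤ + b * (s * w) ≡ a * p → - b * s * w - 1ℤ ≡ - a * p
      lemma a b s w p eq = trans (left b s w) (trans (cong -_ eq) (right a p))
        where
        left : ∀ b s w → - b * s * w - 1ℤ ≡ - (1ℤ + b * (s * w))
        left = solve-∀
        right : ∀ a p → - (a * p) ≡ - a * p
        right = solve-∀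
    ... | GCD.Bézout.Identity.-+ a b eq with divides s w≡ ← m∣∣m∣ {w} =
      ℤ.+ b * s , divides (ℤ.+ a) (lemma (ℤ.+ a) (ℤ.+ b) s w P
        (trans (trans (cong (1ℤ +_) (sym (pos-* a p))) (cong ℤ.+_ eq))
          (trans (pos-* b ℤ.∣ w ∣) (cong (λ z → ℤ.+ b * z) w≡))))
      where
      lemma : ∀ a b s w p → 1ℤ + a * p ≡ b * (s * w) → b * s * w - 1ℤ ≡ a * p
      lemma a b s w p eq = trans (left b s w) (trans (cong (_- 1ℤ) (sym eq)) (right a p))
        where
        left : ∀ b s w → b * s * w - 1ℤ ≡ b * (s * w) - 1ℤ
        left = solve-∀
        right : ∀ a p → 1ℤ + a * p - 1ℤ ≡ a * p
        right = solve-∀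

    module _ (f : Poly k) (g : Poly l)
             (P∣r : P ∣ resultant f g) (P²∤r : ¬ P * P ∣ resultant f g) where

      private
        N : ℕ
        N = k ℕ.+ l

      -- Entry t stands for the value of a linear functional at x^(N - t); passing from e ∘ suc to e
      -- composes it with multiplication by x, which acts as a scalar because the kernel is a line.
      shift-invariant⇒root : ∀ e → Annihilates f g P (e ∘ suc) → Annihilates f g P e →
        P ∣ dot (toList f) (λ t → e (l ℕ.+ t)) → P ∣ dot (toList g) (λ t → e (k ℕ.+ t)) →
        (∃ λ i → i < N × ¬ P ∣ e (suc i)) → ∃ λ x → P ∣ eval f x × P ∣ eval g x
      shift-invariant⇒root e ann ann' annF annG (i₀ , i₀<N , P∤i₀) =
        x , root f l (trans (ℕ.+-comm l k) N≡) annF , root g k N≡ annG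
        where
        N' : ℕ
        N' = ℕ.pred N
        N≡ : N ≡ suc N'
        N≡ = sym (ℕ.suc-pred N ⦃ ℕ.>-nonZero (ℕ.≤-<-trans z≤n i₀<N) ⦄)
        proportional : ∀ i j → i < N → j < N → ¬ P ∣ e (suc i) → P ∣ e (suc i) * e j - e i * e (suc j)
        proportional i j i<N j<N P∤ = subst₂ (λ i j → P ∣ e (suc i) * e j - e i * e (suc j))
          (toℕ-fromℕ< i<N) (toℕ-fromℕ< j<N)
          (kernel-unique (sylvester f g) P∣r P²∤r (e ∘ suc ∘ toℕ) (e ∘ toℕ)
            (annihilates⇒kernel f g (e ∘ suc) ann) (annihilates⇒kernel f g e ann')
            (fromℕ< i<N) (subst (λ i → ¬ P ∣ e (suc i)) (sym (toℕ-fromℕ< i<N)) P∤) (fromℕ< j<N))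
        <N : ∀ {i} → i < suc N' → i < N
        <N {i} = subst (i <_) (sym N≡)
        -- If the following entry vanished, proportionality would make the square of `e (suc i)`
        -- vanish. So nonvanishing climbs to the last entry, the value of the functional at `1`.
        next : ∀ i → suc i < N → ¬ P ∣ e (suc i) → ¬ P ∣ e (suc (suc i))
        next i si<N P∤ P∣ = [ P∤ , P∤ ]′ (P∣* (e (suc i)) (e (suc i))
          (∣m+n∣n⇒∣m (proportional i (suc i) (ℕ.<-trans (ℕ.n<1+n i) si<N) si<N P∤) (∣m⇒∣-m (∣n⇒∣m*n (e i) P∣))))
        climb : ∀ d i → i ℕ.+ d ≡ N' → ¬ P ∣ e (suc i) → ¬ P ∣ e (suc N')
        climb zero    i eq P∤ = subst (λ i → ¬ P ∣ e (suc i)) (trans (sym (ℕ.+-identityʳ i)) eq) P∤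
        climb (suc d) i eq P∤ = climb d (suc i) eq' (next i (<N (s≤s (subst (suc i ≤_) eq' (ℕ.m≤m+n (suc i) d)))) P∤)
          where
          eq' : suc i ℕ.+ d ≡ N'
          eq' = trans (sym (ℕ.+-suc i d)) eq
        P∤last : ¬ P ∣ e (suc N')
        P∤last = climb (N' ℕ.∸ i₀) i₀ (ℕ.m+[n∸m]≡n (s≤s⁻¹ (subst (i₀ <_) N≡ i₀<N))) P∤i₀
        -- The root is the ratio of the values of the functional at x and at `1`.
        w u x : ℤ
        w = e (suc N')
        u = proj₁ (inverse w P∤last)
        x = u * e N'
        geometric : ∀ t → t < N → P ∣ e t - x * e (suc t)
        geometric t t<N = ∣-respʳ (regroup u w (e t) (e N') (e (suc t)))
          (∣m∣n⇒∣m-n (∣n⇒∣m*n u (proportional N' t (<N (ℕ.n<1+n N')) t<N P∤last))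
                     (∣m⇒∣m*n (e t) (proj₂ (inverse w P∤last))))
          where
          regroup : ∀ u w a b c → u * (w * a - b * c) - (u * w - 1ℤ) * a ≡ a - u * b * c
          regroup = solve-∀
        -- Index `l` corresponds to `f` itself, where the functional is `eval f x` times its value
        -- at `1`, a unit mod `p`.
        root : ∀ {k} (f : Poly k) l → l ℕ.+ k ≡ suc N' → P ∣ dot (toList f) (λ t → e (l ℕ.+ t)) → P ∣ eval f x
        root {k} f l l+k≡ annF = [ id , ⊥-elim ∘ subst (λ z → ¬ P ∣ e z) (sym l+k≡) P∤last ]′ (P∣* (eval f x) (e (l ℕ.+ k)) P∣product)
          where
          cancel : ∀ a b → a - (a - b) ≡ b
          cancel = solve-∀
          P∣product : P ∣ eval f x * e (l ℕ.+ k)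
          P∣product = ∣-respʳ (cancel (dot (toList f) (λ t → e (l ℕ.+ t))) (eval f x * e (l ℕ.+ k))) (∣m∣n⇒∣m-n annF (dot-eval f x (λ t → e (l ℕ.+ t))
            (λ t t<k → subst (λ z → P ∣ e (l ℕ.+ t) - x * e z) (sym (ℕ.+-suc l t))
              (geometric (l ℕ.+ t) (<N (subst (l ℕ.+ t <_) l+k≡ (ℕ.+-monoʳ-< l t<k)))))))

      common-root-exists : Monic f → ∃ λ x → P ∣ eval f x × P ∣ eval g x
      common-root-exists monicF with c , ker , j₀ , P∤ ← kernel-exists (sylvester f g) P∣r P²∤r =
        shift-invariant⇒root e ann ((λ i i<l → annF i (ℕ.<⇒≤ i<l)) , (λ i i<k → annG i (ℕ.<⇒≤ i<k)))
          (annF l ℕ.≤-refl) (annG k ℕ.≤-refl)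
          (toℕ j₀ , toℕ<n j₀ , λ P∣ → P∤ (∣-respʳ (extend-toℕ c j₀) P∣))
        where
        e : ℕ → ℤ
        -- The new value at x^N is the one that makes the functional vanish at x^l f, whose leading
        -- coefficient is `1`.
        e zero    = - dot (toList (tail f)) (extend c)
        e (suc t) = extend c t
        ann : Annihilates f g P (extend c)
        ann = kernel⇒annihilates f g (extend c) λ i →
          ∣-respʳ (sumFin-cong (λ t → cong (sylvester f g i t *_) (sym (extend-toℕ c t)))) (ker i)
        annF : ∀ i → i ≤ l → P ∣ dot (toList f) (λ t → e (i ℕ.+ t))
        annF zero    _   = divides 0ℤ (trans (dot-monic f monicF e) (+-inverseˡ (dot (toList (tail f)) (extend c))))
        annF (suc i) i<l = proj₁ ann i i<l
        -- The functional at f g, expanded by the coefficients of g and by those of f; the latter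
        -- isolate x^k g.
        exchange : dot (toList g) (λ s → dot (toList f) (λ t → e (s ℕ.+ t)))
          ≡ dot (toList g) e + dot (toList (tail f)) (λ t → dot (toList g) (λ s → e (suc t ℕ.+ s)))
        exchange = trans (dot-swap (toList g) (toList f) (λ s t → e (s ℕ.+ t)))
          (trans (dot-cong (toList f) (λ t → dot-cong (toList g) (λ s → cong e (ℕ.+-comm s t))))
            (dot-monic f monicF (λ t → dot (toList g) (λ s → e (t ℕ.+ s)))))
        annG : ∀ i → i ≤ k → P ∣ dot (toList g) (λ t → e (i ℕ.+ t))
        annG zero    _   = ∣m+n∣n⇒∣m
          (∣-respʳ exchange (∣-dot (toList g) (λ s s< → annF s (s≤s⁻¹ (subst (s <_) (length-toList g) s<)))))
          (∣-dot (toList (tail f)) (λ t t< → proj₂ ann t (subst (t <_) (length-toList (tail f)) t<)))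
        annG (suc i) i<k = proj₂ ann i i<k

    -- The power vectors of both roots lie on one line and end in `x , 1` and `y , 1`. A constant
    -- monic polynomial has no root mod `p`, so the degrees are positive and two final entries
    -- exist.
    common-root-unique : ∀ (f : Poly k) (g : Poly l) → Monic f → Monic g →
      P ∣ resultant f g → ¬ P * P ∣ resultant f g →
      ∀ x y → P ∣ eval f x → P ∣ eval g x → P ∣ eval f y → P ∣ eval g y → P ∣ y - x
    common-root-unique {zero}  {l}     f g mf mg _ _ x y P∣fx _ _ _ = ⊥-elim (P∤1 (∣-respʳ (eval-constant f x mf) P∣fx))
    common-root-unique {suc k} {zero}  f g mf mg _ _ x y _ P∣gx _ _ = ⊥-elim (P∤1 (∣-respʳ (eval-constant g x mg) P∣gx))
    common-root-unique {suc k} {suc l} f g mf mg P∣r P²∤r x y P∣fx P∣gx P∣fy P∣gy =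
      ∣-respʳ simplify (kernel-unique (sylvester f g) P∣r P²∤r (v x) (v y)
        (annihilates⇒kernel f g (powers f g x N' refl) (powers-annihilate f g x N' refl P∣fx P∣gx))
        (annihilates⇒kernel f g (powers f g y N' refl) (powers-annihilate f g y N' refl P∣fy P∣gy))
        last (P∤1 ∘ ∣-respʳ (v-last x)) previous)
      where
      N' : ℕ
      N' = k ℕ.+ suc l
      v : ℤ → Fin (suc N') → ℤ
      v z = powers f g z N' refl ∘ toℕ
      k+l<N' : k ℕ.+ l < N'
      k+l<N' = ℕ.≤-reflexive (sym (ℕ.+-suc k l))
      last previous : Fin (suc N')
      last     = fromℕ< (ℕ.n<1+n N')
      previous = fromℕ< (ℕ.m≤n⇒m≤1+n k+l<N')
      v-last : ∀ z → v z last ≡ 1ℤ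
      v-last z = cong (z ^_) (trans (cong (N' ℕ.∸_) (toℕ-fromℕ< (ℕ.n<1+n N'))) (ℕ.n∸n≡0 N'))
      v-previous : ∀ z → v z previous ≡ z
      v-previous z = trans (cong (z ^_) (trans (cong (N' ℕ.∸_) (toℕ-fromℕ< (ℕ.m≤n⇒m≤1+n k+l<N')))
        (trans (cong (ℕ._∸ (k ℕ.+ l)) (ℕ.+-suc k l)) (ℕ.m+n∸n≡m 1 (k ℕ.+ l))))) (*-identityʳ z)
      simplify : v x last * v y previous - v y last * v x previous ≡ y - x
      simplify = trans (cong₂ _-_ (cong₂ _*_ (v-last x) (v-previous y)) (cong₂ _*_ (v-last y) (v-previous x)))
        (cong₂ _-_ (*-identityˡ y) (*-identityˡ x))

module ResidueCounts where

  open CommonRoots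
  open import Defs
  open import Data.Bool using (if_then_else_; true; false)
  open import Data.Nat as ℕ using (ℕ; zero; suc; _+_; _*_; _∸_; _<_; _≤_; z≤n; s≤s; s<s; z<s; NonZero)
  import Data.Nat.Properties as ℕ
  import Data.Nat.Divisibility as ℕ
  open import Data.Nat.Divisibility using () renaming (_∣_ to _∣ₙ_; _∣?_ to _∣?ₙ_)
  open import Data.Nat.GCD using (gcd; gcd[m,n]∣m; gcd[m,n]∣n; gcd-greatest; gcd-comm; c*gcd[m,n]≡gcd[cm,cn])
  open import Data.Nat.Coprimality using (coprime-divisor)
  open import Data.Nat.ListAction using (product)
  open import Data.Nat.Primality using (Prime; prime?; prime⇒irreducible; prime⇒nonZero; prime⇒nonTrivial; euclidsLemma)
  import Data.Nat.Tactic.RingSolver as ℕR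
  open import Data.Integer as ℤ using (ℤ; 1ℤ; _-_; _%ℕ_; _/ℕ_)
  open import Data.Integer.DivMod using (n%ℕd<d; a≡a%ℕn+[a/ℕn]*n)
  open import Data.Integer.Properties using (pos-*; m-n≡m⊖n; ⊖-≥)
  open import Data.Integer.Divisibility.Signed using (_∣_; ∣ᵤ⇒∣; ∣⇒∣ᵤ; ∣-trans; ∣m∣n⇒∣m-n; ∣m⇒∣-m; ∣n⇒∣m*n; ∣m⇒∣m*n)
  open import Data.Integer.Tactic.RingSolver using (solve-∀)
  open import Data.List using ([]; _∷_; length; filter; applyUpTo; map)
  open import Data.List.Relation.Unary.All using (All; []; _∷_)
  open import Data.Product using (_×_; ∃; _,_; proj₁; proj₂)
  open import Data.Sum using (inj₁; inj₂; [_,_]′)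
  open import Data.Empty using (⊥-elim)
  open import Function using (_∘_; id)
  open import Relation.Nullary using (yes; no; ¬_; Dec; does)
  open import Relation.Nullary.Decidable using (_×-dec_)
  open import Relation.Unary using (Decidable)
  open import Relation.Binary.PropositionalEquality

  -- Sums and products over initial segments.

  sumTo : ℕ → (ℕ → ℕ) → ℕ
  sumTo zero    h = 0
  sumTo (suc n) h = h 0 + sumTo n (h ∘ suc)

  prodTo : ℕ → (ℕ → ℕ) → ℕ
  prodTo zero    h = 1
  prodTo (suc n) h = h 0 * prodTo n (h ∘ suc)

  if-yes : ∀ {A : Set} (A? : Dec A) {x y : ℕ} → A → (if does A? then x else y) ≡ x
  if-yes (yes _) a = refl
  if-yes (no ¬a) a = ⊥-elim (¬a a)

  if-no : ∀ {A : Set} (A? : Dec A) {x y : ℕ} → ¬ A → (if does A? then x else y) ≡ y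
  if-no (yes a) ¬a = ⊥-elim (¬a a)
  if-no (no _)  ¬a = refl

  indicator : ∀ {A : Set} → Dec A → ℕ
  indicator A? = if does A? then 1 else 0

  indicator-⇔ : ∀ {A B : Set} (A? : Dec A) (B? : Dec B) → (A → B) → (B → A) → indicator A? ≡ indicator B?
  indicator-⇔ (yes a) B? to from = sym (if-yes B? (to a))
  indicator-⇔ (no ¬a) B? to from = sym (if-no B? (¬a ∘ from))

  length-filter-applyUpTo : ∀ {P : ℕ → Set} (P? : Decidable P) φ n →
    length (filter P? (applyUpTo φ n)) ≡ sumTo n (λ i → indicator (P? (φ i)))
  length-filter-applyUpTo P? φ zero = refl
  length-filter-applyUpTo P? φ (suc n) with does (P? (φ 0))
  ... | true  = cong suc (length-filter-applyUpTo P? (φ ∘ suc) n)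
  ... | false = length-filter-applyUpTo P? (φ ∘ suc) n

  product-filter-applyUpTo : ∀ {P : ℕ → Set} (P? : Decidable P) w φ n →
    product (map w (filter P? (applyUpTo φ n))) ≡ prodTo n (λ i → if does (P? (φ i)) then w (φ i) else 1)
  product-filter-applyUpTo P? w φ zero = refl
  product-filter-applyUpTo P? w φ (suc n) with does (P? (φ 0))
  ... | true  = cong (w (φ 0) *_) (product-filter-applyUpTo P? w (φ ∘ suc) n)
  ... | false = trans (product-filter-applyUpTo P? w (φ ∘ suc) n) (sym (ℕ.*-identityˡ _))

  sumTo-cong : ∀ n {h h'} → (∀ i → h i ≡ h' i) → sumTo n h ≡ sumTo n h'
  sumTo-cong zero    eq = refl
  sumTo-cong (suc n) eq = cong₂ _+_ (eq 0) (sumTo-cong n (eq ∘ suc))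

  sumTo-zero : ∀ n {h} → (∀ i → i < n → h i ≡ 0) → sumTo n h ≡ 0
  sumTo-zero zero    eq = refl
  sumTo-zero (suc n) eq = cong₂ _+_ (eq 0 z<s) (sumTo-zero n (λ i i<n → eq (suc i) (s<s i<n)))

  sumTo-zipWith-+ : ∀ n h h' → sumTo n (λ i → h i + h' i) ≡ sumTo n h + sumTo n h'
  sumTo-zipWith-+ zero    h h' = refl
  sumTo-zipWith-+ (suc n) h h' = trans (cong (h 0 + h' 0 +_) (sumTo-zipWith-+ n (h ∘ suc) (h' ∘ suc)))
    (interchange (h 0) (h' 0) (sumTo n (h ∘ suc)) (sumTo n (h' ∘ suc)))
    where
    interchange : ∀ a b c d → a + b + (c + d) ≡ a + c + (b + d)
    interchange = ℕR.solve-∀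

  sumTo-*ʳ : ∀ n h c → sumTo n (λ i → h i * c) ≡ sumTo n h * c
  sumTo-*ʳ zero    h c = refl
  sumTo-*ʳ (suc n) h c = trans (cong (h 0 * c +_) (sumTo-*ʳ n (h ∘ suc) c)) (sym (ℕ.*-distribʳ-+ c (h 0) _))

  sumTo-split : ∀ m n h → sumTo (m + n) h ≡ sumTo m h + sumTo n (λ i → h (m + i))
  sumTo-split zero    n h = refl
  sumTo-split (suc m) n h = trans (cong (h 0 +_) (sumTo-split m n (h ∘ suc))) (sym (ℕ.+-assoc (h 0) _ _))

  sumTo-blocks : ∀ p B h → sumTo (p * B) h ≡ sumTo p (λ t → sumTo B (λ j → h (t * B + j)))
  sumTo-blocks zero    B h = refl
  sumTo-blocks (suc p) B h = trans (sumTo-split B (p * B) h) (cong (sumTo B h +_)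
    (trans (sumTo-blocks p B (λ i → h (B + i)))
      (sumTo-cong p (λ t → sumTo-cong B (λ j → cong h (sym (ℕ.+-assoc B (t * B) j)))))))

  sumTo-swap : ∀ m n (h : ℕ → ℕ → ℕ) → sumTo m (λ i → sumTo n (h i)) ≡ sumTo n (λ j → sumTo m (λ i → h i j))
  sumTo-swap zero    n h = sym (sumTo-zero n (λ _ _ → refl))
  sumTo-swap (suc m) n h = trans (cong (sumTo n (h 0) +_) (sumTo-swap m n (h ∘ suc)))
    (sym (sumTo-zipWith-+ n (h 0) (λ j → sumTo m (λ i → h (suc i) j))))

  sumTo-single : ∀ n h j → j < n → (∀ i → i < n → i ≢ j → h i ≡ 0) → sumTo n h ≡ h j
  sumTo-single (suc n) h zero    j<n others = trans
    (cong (h 0 +_) (sumTo-zero n (λ i i<n → others (suc i) (s<s i<n) (λ ())))) (ℕ.+-identityʳ (h 0))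
  sumTo-single (suc n) h (suc j) (s<s j<n) others = trans
    (cong (_+ sumTo n (h ∘ suc)) (others 0 z<s (λ ())))
    (sumTo-single n (h ∘ suc) j j<n (λ i i<n i≢j → others (suc i) (s<s i<n) (i≢j ∘ ℕ.suc-injective)))

  sumTo-indicator≢0 : ∀ n {P : ℕ → Set} (P? : Decidable P) → sumTo n (λ i → indicator (P? i)) ≢ 0 → ∃ P
  sumTo-indicator≢0 zero    P? ≢0 = ⊥-elim (≢0 refl)
  sumTo-indicator≢0 (suc n) P? ≢0 with P? 0
  ... | yes p0 = 0 , p0
  ... | no _ with i , pi ← sumTo-indicator≢0 n (P? ∘ suc) ≢0 = suc i , pi

  prodTo-cong : ∀ n {h h'} → (∀ i → h i ≡ h' i) → prodTo n h ≡ prodTo n h'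
  prodTo-cong zero    eq = refl
  prodTo-cong (suc n) eq = cong₂ _*_ (eq 0) (prodTo-cong n (eq ∘ suc))

  prodTo-zipWith-* : ∀ n h h' → prodTo n (λ i → h i * h' i) ≡ prodTo n h * prodTo n h'
  prodTo-zipWith-* zero    h h' = refl
  prodTo-zipWith-* (suc n) h h' = trans (cong (h 0 * h' 0 *_) (prodTo-zipWith-* n (h ∘ suc) (h' ∘ suc)))
    (interchange (h 0) (h' 0) (prodTo n (h ∘ suc)) (prodTo n (h' ∘ suc)))
    where
    interchange : ∀ a b c d → a * b * (c * d) ≡ a * c * (b * d)
    interchange = ℕR.solve-∀

  prodTo-one : ∀ n {h} → (∀ i → h i ≡ 1) → prodTo n h ≡ 1
  prodTo-one zero    eq = refl
  prodTo-one (suc n) eq = cong₂ _*_ (eq 0) (prodTo-one n (eq ∘ suc))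

  prodTo-extend : ∀ {m n} h → m ≤ n → (∀ i → m ≤ i → h i ≡ 1) → prodTo n h ≡ prodTo m h
  prodTo-extend {n = n} h z≤n ones = prodTo-one n (λ i → ones i z≤n)
  prodTo-extend h (s≤s m≤n) ones = cong (h 0 *_) (prodTo-extend (h ∘ suc) m≤n (λ i m≤i → ones (suc i) (s≤s m≤i)))

  prodTo-single : ∀ n h j → j < n → (∀ i → i ≢ j → h i ≡ 1) → prodTo n h ≡ h j
  prodTo-single (suc n) h zero    j<n others = trans
    (cong (h 0 *_) (prodTo-one n (λ i → others (suc i) (λ ())))) (ℕ.*-identityʳ (h 0))
  prodTo-single (suc n) h (suc j) (s<s j<n) others = trans
    (cong₂ _*_ (others 0 (λ ())) (prodTo-single n (h ∘ suc) j j<n (λ i i≢j → others (suc i) (i≢j ∘ ℕ.suc-injective))))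
    (ℕ.*-identityˡ (h (suc j)))

  prodTo-≢0 : ∀ n h → (∀ i → h i ≢ 0) → prodTo n h ≢ 0
  prodTo-≢0 zero    h ≢0 = λ ()
  prodTo-≢0 (suc n) h ≢0 eq = [ ≢0 0 , prodTo-≢0 n (h ∘ suc) (≢0 ∘ suc) ]′ (ℕ.m*n≡0⇒m≡0∨n≡0 (h 0) eq)

  -- The product of p - 1 over the primes dividing a number.

  primeFactor : ℕ → ℕ → ℕ
  primeFactor m j = if does (prime? j ×-dec (j ∣?ₙ m)) then j ∸ 1 else 1

  primeProd≡prodTo : ∀ m → primeProd m ≡ prodTo (suc m) (primeFactor m)
  primeProd≡prodTo m = product-filter-applyUpTo (λ p → prime? p ×-dec (p ∣?ₙ m)) (_∸ 1) id (suc m)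

  -- A prime is at least two, so no factor is zero. This later turns a count into existence.
  primeProd-≢0 : ∀ m → primeProd m ≢ 0
  primeProd-≢0 m eq = prodTo-≢0 (suc m) (primeFactor m) factor≢0 (trans (sym (primeProd≡prodTo m)) eq)
    where
    factor≢0 : ∀ j → primeFactor m j ≢ 0
    factor≢0 j with prime? j ×-dec (j ∣?ₙ m)
    ... | no ¬both     = λ eq → ℕ.1+n≢0 (trans (sym (if-no (prime? j ×-dec (j ∣?ₙ m)) ¬both)) eq)
    ... | yes both@(pr , _) = λ eq → ℕ.m>n⇒m∸n≢0 (ℕ.nonTrivial⇒n>1 j ⦃ prime⇒nonTrivial pr ⦄)
                           (trans (sym (if-yes (prime? j ×-dec (j ∣?ₙ m)) both)) eq)

  -- The factors split pointwise into that of `p` and those of `m`. The two products have different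
  -- ranges, but no number above `m` divides `m`, so the longer range only adds ones.
  primeProd-* : ∀ {p m} .⦃ _ : NonZero m ⦄ → Prime p → ¬ p ∣ₙ m → primeProd (p * m) ≡ (p ∸ 1) * primeProd m
  primeProd-* {p} {m} pr p∤m = begin
    primeProd (p * m)                                     ≡⟨ primeProd≡prodTo (p * m) ⟩
    prodTo (suc (p * m)) (primeFactor (p * m))            ≡⟨ prodTo-cong (suc (p * m)) split ⟩
    prodTo (suc (p * m)) (λ j → single j * primeFactor m j) ≡⟨ prodTo-zipWith-* (suc (p * m)) single (primeFactor m) ⟩
    prodTo (suc (p * m)) single * prodTo (suc (p * m)) (primeFactor m)
      ≡⟨ cong₂ _*_ (trans (prodTo-single (suc (p * m)) single p (s≤s (ℕ.m≤m*n p m)) (λ i i≢p → if-no (i ℕ.≟ p) i≢p))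
                          (if-yes (p ℕ.≟ p) refl))
                   (trans (prodTo-extend (primeFactor m) (s≤s (ℕ.m≤n*m m p ⦃ prime⇒nonZero pr ⦄)) beyond)
                          (sym (primeProd≡prodTo m))) ⟩
    (p ∸ 1) * primeProd m                                 ∎
    where
    open ≡-Reasoning
    single : ℕ → ℕ
    single j = if does (j ℕ.≟ p) then p ∸ 1 else 1
    beyond : ∀ j → suc m ≤ j → primeFactor m j ≡ 1
    beyond j m<j = if-no (prime? j ×-dec (j ∣?ₙ m)) (λ (_ , j∣m) → ℕ.>⇒∤ m<j j∣m)
    split : ∀ j → primeFactor (p * m) j ≡ single j * primeFactor m j
    split j with j ℕ.≟ p
    ... | yes refl = trans (if-yes (prime? j ×-dec (j ∣?ₙ (p * m))) (pr , ℕ.m∣m*n m))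
                       (sym (trans (cong₂ _*_ (if-yes (j ℕ.≟ j) refl) (if-no (prime? j ×-dec (j ∣?ₙ m)) (p∤m ∘ proj₂))) (ℕ.*-identityʳ (j ∸ 1))))
    ... | no j≢p = trans other (sym (trans (cong (_* primeFactor m j) (if-no (j ℕ.≟ p) j≢p)) (ℕ.*-identityˡ (primeFactor m j))))
      where
      other : primeFactor (p * m) j ≡ primeFactor m j
      other with prime? j ×-dec (j ∣?ₙ m)
      ... | yes (prj , j∣m) = trans (if-yes (prime? j ×-dec (j ∣?ₙ (p * m))) (prj , ℕ.∣n⇒∣m*n p j∣m))
                                (sym (if-yes (prime? j ×-dec (j ∣?ₙ m)) (prj , j∣m)))
      ... | no ¬both = trans (if-no (prime? j ×-dec (j ∣?ₙ (p * m))) λ (prj , j∣pm) →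
                [ (λ j∣p → [ prime≢1 prj , j≢p ]′ (prime⇒irreducible pr j∣p)) , (λ j∣m → ¬both (prj , j∣m)) ]′
                  (euclidsLemma p m prj j∣pm))
              (sym (if-no (prime? j ×-dec (j ∣?ₙ m)) ¬both))

  -- Gcds, block sums and residues when a prime joins the modulus.

  gcd-*ˡ-coprime : ∀ {p n} m → Prime p → ¬ p ∣ₙ n → gcd n (p * m) ≡ gcd n m
  gcd-*ˡ-coprime {p} {n} m pr p∤n = ℕ.∣-antisym
    (gcd-greatest g∣n (coprime-divisor (∤⇒coprime pr (λ p∣g → p∤n (ℕ.∣-trans p∣g g∣n))) (gcd[m,n]∣n n (p * m))))
    (gcd-greatest (gcd[m,n]∣m n m) (ℕ.∣n⇒∣m*n p (gcd[m,n]∣n n m)))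
    where
    g∣n : gcd n (p * m) ∣ₙ n
    g∣n = gcd[m,n]∣m n (p * m)

  -- Taking `p` out leaves the gcd of `n / p` with `m`; as `p` does not divide `m`, restoring `p` in
  -- the first argument changes nothing.
  gcd-*-common : ∀ {p n m} → Prime p → p ∣ₙ n → ¬ p ∣ₙ m → gcd n (p * m) ≡ p * gcd n m
  gcd-*-common {p} {n} {m} pr (ℕ.divides q refl) p∤m = begin
    gcd (q * p) (p * m) ≡⟨ cong (λ z → gcd z (p * m)) (ℕ.*-comm q p) ⟩
    gcd (p * q) (p * m) ≡⟨ sym (c*gcd[m,n]≡gcd[cm,cn] p q m) ⟩
    p * gcd q m         ≡⟨ cong (p *_) (begin
      gcd q m       ≡⟨ gcd-comm q m ⟩
      gcd m q       ≡⟨ sym (gcd-*ˡ-coprime q pr p∤m) ⟩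
      gcd m (p * q) ≡⟨ gcd-comm m (p * q) ⟩
      gcd (p * q) m ≡⟨ cong (λ z → gcd z m) (ℕ.*-comm p q) ⟩
      gcd (q * p) m ∎) ⟩
    p * gcd (q * p) m   ∎
    where open ≡-Reasoning

  -- Arranged as `p` blocks of length `B` and summed over the blocks first, each position `j` keeps
  -- `b j` exactly once.
  sumTo-transversal : ∀ p B (a b : ℕ → ℕ) → (∀ t j → b (t * B + j) ≡ b j) → (∀ j → sumTo p (λ t → a (t * B + j)) ≡ 1) →
    sumTo (p * B) (λ i → a i * b i) ≡ sumTo B b
  sumTo-transversal p B a b period once = begin
    sumTo (p * B) (λ i → a i * b i)
      ≡⟨ sumTo-blocks p B (λ i → a i * b i) ⟩
    sumTo p (λ t → sumTo B (λ j → a (t * B + j) * b (t * B + j)))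
      ≡⟨ sumTo-swap p B (λ t j → a (t * B + j) * b (t * B + j)) ⟩
    sumTo B (λ j → sumTo p (λ t → a (t * B + j) * b (t * B + j)))
      ≡⟨ sumTo-cong B (λ j → trans (sumTo-cong p (λ t → cong (a (t * B + j) *_) (period t j)))
           (trans (sumTo-*ʳ p (λ t → a (t * B + j)) (b j)) (trans (cong (_* b j) (once j)) (ℕ.*-identityˡ (b j))))) ⟩
    sumTo B b ∎
    where open ≡-Reasoning

  sumTo-repeat : ∀ p B b → (∀ t j → b (t * B + j) ≡ b j) → sumTo (p * B) b ≡ p * sumTo B b
  sumTo-repeat p B b period = trans (sumTo-blocks p B b)
    (trans (sumTo-cong p (λ t → sumTo-cong B (period t))) (constant p (sumTo B b)))
    where
    constant : ∀ p c → sumTo p (λ _ → c) ≡ p * c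
    constant zero    c = refl
    constant (suc p) c = cong (c +_) (constant p c)

  residue-unique : ∀ {p s t} → s < p → t < p → ℤ.+ p ∣ ℤ.+ s - ℤ.+ t → s ≡ t
  residue-unique {p} {s} {t} s<p t<p p∣ = ℕ.≤-antisym (upper s<p p∣) (upper t<p (∣-respʳ (flip (ℤ.+ s) (ℤ.+ t)) (∣m⇒∣-m p∣)))
    where
    flip : ∀ a b → ℤ.- (a - b) ≡ b - a
    flip = solve-∀
    vanish : ∀ x → x < p → p ∣ₙ x → x ≡ 0
    vanish zero    x<p p∣x = refl
    vanish (suc x) x<p p∣x = ⊥-elim (ℕ.>⇒∤ x<p p∣x)
    upper : ∀ {s t} → s < p → ℤ.+ p ∣ ℤ.+ s - ℤ.+ t → s ≤ t
    upper {s} {t} s<p p∣ with ℕ.≤-total s t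
    ... | inj₁ s≤t = s≤t
    ... | inj₂ t≤s = ℕ.m∸n≡0⇒m≤n (vanish (s ∸ t) (ℕ.≤-<-trans (ℕ.m∸n≤m s t) s<p)
                       (∣⇒∣ᵤ (∣-respʳ (trans (m-n≡m⊖n s t) (⊖-≥ t≤s)) p∣)))

  solve-residue : ∀ {p} → Prime p → ∀ B → ¬ p ∣ₙ B → ∀ (y : ℤ) → ∃ λ t → t < p × ℤ.+ p ∣ ℤ.+ (t * B) - y
  solve-residue {p} pr B p∤B y with u , p∣uB-1 ← CommonRoot.inverse pr (ℤ.+ B) (λ p∣B → p∤B (∣⇒∣ᵤ p∣B)) =
    t , n%ℕd<d (u ℤ.* y) p , ∣-respʳ (sym combine)
      (∣m∣n⇒∣m-n (∣m⇒∣m*n y p∣uB-1) (∣m⇒∣m*n (ℤ.+ B) (∣n⇒∣m*n q (∣ᵤ⇒∣ {i = ℤ.+ p} ℕ.∣-refl))))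
    where
    instance
      p≢0 : NonZero p
      p≢0 = prime⇒nonZero pr
    -- `u` inverts `B` mod `p`, so the solution is `u` times `y`, reduced.
    t : ℕ
    t = (u ℤ.* y) %ℕ p
    q : ℤ
    q = (u ℤ.* y) /ℕ p
    isolate : ∀ t q p → t ≡ (t ℤ.+ q ℤ.* p) - q ℤ.* p
    isolate = solve-∀
    regroup : ∀ u y c b → (u ℤ.* y - c) ℤ.* b - y ≡ (u ℤ.* b - 1ℤ) ℤ.* y - c ℤ.* b
    regroup = solve-∀
    combine : ℤ.+ (t * B) - y ≡ (u ℤ.* ℤ.+ B - 1ℤ) ℤ.* y - q ℤ.* ℤ.+ p ℤ.* ℤ.+ B
    combine = begin
      ℤ.+ (t * B) - y                             ≡⟨ cong (_- y) (pos-* t B) ⟩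
      ℤ.+ t ℤ.* ℤ.+ B - y                         ≡⟨ cong (λ z → z ℤ.* ℤ.+ B - y) (isolate (ℤ.+ t) q (ℤ.+ p)) ⟩
      ((ℤ.+ t ℤ.+ q ℤ.* ℤ.+ p) - q ℤ.* ℤ.+ p) ℤ.* ℤ.+ B - y
        ≡⟨ cong (λ z → (z - q ℤ.* ℤ.+ p) ℤ.* ℤ.+ B - y) (sym (a≡a%ℕn+[a/ℕn]*n (u ℤ.* y) p)) ⟩
      (u ℤ.* y - q ℤ.* ℤ.+ p) ℤ.* ℤ.+ B - y       ≡⟨ regroup u y (q ℤ.* ℤ.+ p) (ℤ.+ B) ⟩
      (u ℤ.* ℤ.+ B - 1ℤ) ℤ.* y - q ℤ.* ℤ.+ p ℤ.* ℤ.+ B ∎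
      where open ≡-Reasoning

  -- Counting gcd classes in a window of consecutive integers.

  module Counting
    (G : ℤ → ℕ)
    (G-cong : ∀ {m x y} → ℤ.+ m ∣ x - y → m ∣ₙ G x → m ∣ₙ G y)
    where

    UniqueRoot : ℕ → Set
    UniqueRoot p = (∃ λ x → p ∣ₙ G x) × (∀ x y → p ∣ₙ G x → p ∣ₙ G y → ℤ.+ p ∣ y - x)

    -- The gcd with `B` depends only on the residue mod `B`, so a window of length `B` is a full
    -- period. Once `B` is a multiple of all values of `G`, it is `G` itself that is counted.
    count : ℤ → ℕ → ℕ → ℕ
    count a B d = sumTo B (λ i → indicator (gcd (G (a ℤ.+ ℤ.+ i)) B ℕ.≟ d))

    module _ (a : ℤ) (p B : ℕ) (pr : Prime p) (p∤B : ¬ p ∣ₙ B) (root : UniqueRoot p) where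

      private
        at : ℕ → ℕ
        at i = G (a ℤ.+ ℤ.+ i)
        root? : ℕ → ℕ
        root? i = indicator (p ∣?ₙ at i)
        x : ℤ
        x = proj₁ (proj₁ root)
        p∣Gx : p ∣ₙ G x
        p∣Gx = proj₂ (proj₁ root)
        class : ℕ → ℕ → ℕ
        class d i = indicator (gcd (at i) B ℕ.≟ d)

      -- As `p` does not divide `B`, the numbers `t * B + j` meet each residue mod `p` once, and the
      -- roots form a single residue.
      root-once : ∀ j → sumTo p (λ t → root? (t * B + j)) ≡ 1
      root-once j =
        trans (sumTo-single p (λ t → root? (t * B + j)) t₀ t₀<p
                (λ t t<p t≢t₀ → if-no (p ∣?ₙ at (t * B + j)) (λ p∣t → t≢t₀ (same t t<p p∣t))))
              (if-yes (p ∣?ₙ at (t₀ * B + j)) p∣at)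
        where
        solution : ∃ λ t → t < p × ℤ.+ p ∣ ℤ.+ (t * B) - (x - (a ℤ.+ ℤ.+ j))
        solution = solve-residue pr B p∤B (x - (a ℤ.+ ℤ.+ j))
        t₀ : ℕ
        t₀ = proj₁ solution
        t₀<p : t₀ < p
        t₀<p = proj₁ (proj₂ solution)
        p∣t₀ : ℤ.+ p ∣ ℤ.+ (t₀ * B) - (x - (a ℤ.+ ℤ.+ j))
        p∣t₀ = proj₂ (proj₂ solution)
        p∣at : p ∣ₙ at (t₀ * B + j)
        p∣at = G-cong (∣-respʳ (flip (ℤ.+ (t₀ * B)) x a (ℤ.+ j)) (∣m⇒∣-m p∣t₀)) p∣Gx
          where
          flip : ∀ b x a j → ℤ.- (b - (x - (a ℤ.+ j))) ≡ x - (a ℤ.+ (b ℤ.+ j))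
          flip = solve-∀
        same : ∀ t → t < p → p ∣ₙ at (t * B + j) → t ≡ t₀
        same t t<p p∣t = residue-unique t<p t₀<p
          ([ id , (λ p∣B → ⊥-elim (p∤B (∣⇒∣ᵤ p∣B))) ]′ (ModPrime.P∣* pr (ℤ.+ t - ℤ.+ t₀) (ℤ.+ B)
            (∣-respʳ difference (proj₂ root _ _ p∣at p∣t))))
          where
          cancel : ∀ a b b' j t t₀ B → b ≡ t ℤ.* B → b' ≡ t₀ ℤ.* B →
            a ℤ.+ (b ℤ.+ j) - (a ℤ.+ (b' ℤ.+ j)) ≡ (t - t₀) ℤ.* B
          cancel a _ _ j t t₀ B refl refl = ring a j t t₀ B
            where
            ring : ∀ a j t t₀ B → a ℤ.+ (t ℤ.* B ℤ.+ j) - (a ℤ.+ (t₀ ℤ.* B ℤ.+ j)) ≡ (t - t₀) ℤ.* B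
            ring = solve-∀
          difference : a ℤ.+ ℤ.+ (t * B + j) - (a ℤ.+ ℤ.+ (t₀ * B + j)) ≡ (ℤ.+ t - ℤ.+ t₀) ℤ.* ℤ.+ B
          difference = cancel a (ℤ.+ (t * B)) (ℤ.+ (t₀ * B)) (ℤ.+ j) (ℤ.+ t) (ℤ.+ t₀) (ℤ.+ B) (pos-* t B) (pos-* t₀ B)

      -- The gcd at one point divides `B`, hence the difference of the points, so `G-cong` carries
      -- it over. The two gcds divide each other.
      class-periodic : ∀ d t j → class d (t * B + j) ≡ class d j
      class-periodic d t j = cong (λ g → indicator (g ℕ.≟ d))
        (ℕ.∣-antisym (divides-gcd forward) (divides-gcd backward))
        where
        forward : ℤ.+ B ∣ (a ℤ.+ ℤ.+ (t * B + j)) - (a ℤ.+ ℤ.+ j)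
        forward = ∣-respʳ (cancel a (ℤ.+ (t * B)) (ℤ.+ j)) (∣ᵤ⇒∣ (ℕ.n∣m*n t))
          where
          cancel : ∀ a b j → b ≡ a ℤ.+ (b ℤ.+ j) - (a ℤ.+ j)
          cancel = solve-∀
        backward : ℤ.+ B ∣ (a ℤ.+ ℤ.+ j) - (a ℤ.+ ℤ.+ (t * B + j))
        backward = ∣-respʳ (negate (a ℤ.+ ℤ.+ (t * B + j)) (a ℤ.+ ℤ.+ j)) (∣m⇒∣-m forward)
          where
          negate : ∀ x y → ℤ.- (x - y) ≡ y - x
          negate = solve-∀
        divides-gcd : ∀ {x y} → ℤ.+ B ∣ x - y → gcd (G x) B ∣ₙ gcd (G y) B
        divides-gcd {x} {y} B∣ = gcd-greatest
          (G-cong {x = x} (∣-trans (∣ᵤ⇒∣ (gcd[m,n]∣n (G x) B)) B∣) (gcd[m,n]∣m (G x) B))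
          (gcd[m,n]∣n (G x) B)

      -- The gcd with `p * B` is `p * d` exactly at the roots mod `p` of class `d`, and each
      -- position of class `d` mod `B` has one such lift.
      count-with-root : ∀ d → count a (p * B) (p * d) ≡ count a B d
      count-with-root d = trans (sumTo-cong (p * B) factor)
        (sumTo-transversal p B root? (class d) (class-periodic d) root-once)
        where
        factor : ∀ i → indicator (gcd (at i) (p * B) ℕ.≟ p * d) ≡ root? i * class d i
        factor i with p ∣?ₙ at i
        ... | yes p∣at = trans (indicator-⇔ (gcd (at i) (p * B) ℕ.≟ p * d) (gcd (at i) B ℕ.≟ d)
                  (λ eq → ℕ.*-cancelˡ-≡ _ _ p ⦃ prime⇒nonZero pr ⦄ (trans (sym (gcd-*-common pr p∣at p∤B)) eq))
                  (λ eq → trans (gcd-*-common pr p∣at p∤B) (cong (p *_) eq)))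
                (sym (ℕ.*-identityˡ (class d i)))
        ... | no p∤at = if-no (gcd (at i) (p * B) ℕ.≟ p * d)
                  (λ eq → p∤at (ℕ.∣-trans (subst (p ∣ₙ_) (sym eq) (ℕ.m∣m*n d)) (gcd[m,n]∣m (at i) (p * B))))

      -- Each position of class `d` mod `B` has `p` lifts. The one at a root acquires the factor
      -- `p`; the others keep the gcd `d`.
      count-without-root : ∀ d → ¬ p ∣ₙ d → count a (p * B) d ≡ (p ∸ 1) * count a B d
      -- The lifts at roots are added to both sides, which avoids truncated subtraction.
      count-without-root d p∤d = ℕ.+-cancelˡ-≡ (count a B d) _ _ (begin
        count a B d + count a (p * B) d
          ≡⟨ cong (_+ count a (p * B) d) (sym (sumTo-transversal p B root? (class d) (class-periodic d) root-once)) ⟩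
        sumTo (p * B) (λ i → root? i * class d i) + count a (p * B) d
          ≡⟨ sym (sumTo-zipWith-+ (p * B) (λ i → root? i * class d i) _) ⟩
        sumTo (p * B) (λ i → root? i * class d i + indicator (gcd (at i) (p * B) ℕ.≟ d))
          ≡⟨ sumTo-cong (p * B) partition ⟩
        sumTo (p * B) (class d)
          ≡⟨ sumTo-repeat p B (class d) (class-periodic d) ⟩
        p * count a B d
          ≡⟨ cong (_* count a B d) (sym (ℕ.suc-pred p ⦃ prime⇒nonZero pr ⦄)) ⟩
        count a B d + (p ∸ 1) * count a B d ∎)
        where
        open ≡-Reasoning
        partition : ∀ i → root? i * class d i + indicator (gcd (at i) (p * B) ℕ.≟ d) ≡ class d i
        partition i with p ∣?ₙ at i
        ... | yes p∣at = trans (cong₂ _+_ (ℕ.*-identityˡ (class d i))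
                  (if-no (gcd (at i) (p * B) ℕ.≟ d)
                    (λ eq → p∤d (subst (p ∣ₙ_) (trans (sym (gcd-*-common pr p∣at p∤B)) eq) (ℕ.m∣m*n (gcd (at i) B))))))
                (ℕ.+-identityʳ (class d i))
        ... | no p∤at = cong (λ g → indicator (g ℕ.≟ d)) (gcd-*ˡ-coprime B pr p∤at)

    squarefree-factor : ∀ {p B} → Prime p → (∀ m → m * m ∣ₙ p * B → m ≡ 1) → ¬ p ∣ₙ B
    squarefree-factor {p} pr sf p∣B = prime≢1 pr (sf p (ℕ.*-monoʳ-∣ p p∣B))

    -- A prime that goes into `d` leaves the count unchanged; one that goes into `q` multiplies it
    -- by `p ∸ 1`, as it does `primeProd q`.
    count≡primeProd : ∀ ps → All Prime ps → All UniqueRoot ps → (∀ m → m * m ∣ₙ product ps → m ≡ 1) →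
      ∀ d q → d * q ≡ product ps → ∀ a → count a (product ps) d ≡ primeProd q
    -- The modulus is `1`: the window is one integer, whose gcd with `1` is `1`.
    count≡primeProd [] [] [] sf d q dq≡1 a
      rewrite ℕ.m*n≡1⇒m≡1 d q dq≡1 | ℕ.m*n≡1⇒n≡1 d q dq≡1 =
      trans (ℕ.+-identityʳ _) (if-yes (gcd (G (a ℤ.+ ℤ.+ 0)) 1 ℕ.≟ 1) (ℕ.∣1⇒≡1 (gcd[m,n]∣n (G (a ℤ.+ ℤ.+ 0)) 1)))
    count≡primeProd (p ∷ ps) (pr ∷ prs) (root ∷ roots) sf d q dq≡ a
      with euclidsLemma d q pr (subst (p ∣ₙ_) (sym dq≡) (ℕ.m∣m*n (product ps)))
    ... | inj₁ (ℕ.divides d' refl) = trans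
        (trans (cong (count a (p * B)) (ℕ.*-comm d' p)) (count-with-root a p B pr p∤B root d'))
        (count≡primeProd ps prs roots sfB d' q d'q≡B a)
      where
      B : ℕ
      B = product ps
      p∤B : ¬ p ∣ₙ B
      p∤B = squarefree-factor pr sf
      sfB : ∀ m → m * m ∣ₙ B → m ≡ 1
      sfB m m²∣B = sf m (ℕ.∣n⇒∣m*n p m²∣B)
      d'q≡B : d' * q ≡ B
      d'q≡B = ℕ.*-cancelˡ-≡ _ _ p ⦃ prime⇒nonZero pr ⦄ (trans (reorder p d' q) dq≡)
        where
        reorder : ∀ p d q → p * (d * q) ≡ d * p * q
        reorder = ℕR.solve-∀
    ... | inj₂ (ℕ.divides q' refl) = begin
        count a (p * B) d           ≡⟨ count-without-root a p B pr p∤B root d (λ p∣d → p∤B (ℕ.∣-trans p∣d (ℕ.divides q' (trans (sym dq'≡B) (ℕ.*-comm d q'))))) ⟩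
        (p ∸ 1) * count a B d       ≡⟨ cong ((p ∸ 1) *_) (count≡primeProd ps prs roots sfB d q' dq'≡B a) ⟩
        (p ∸ 1) * primeProd q'      ≡⟨ sym (primeProd-* ⦃ q'≢0 ⦄ pr p∤q') ⟩
        primeProd (p * q')          ≡⟨ cong primeProd (ℕ.*-comm p q') ⟩
        primeProd (q' * p)          ∎
      where
      open ≡-Reasoning
      B : ℕ
      B = product ps
      p∤B : ¬ p ∣ₙ B
      p∤B = squarefree-factor pr sf
      sfB : ∀ m → m * m ∣ₙ B → m ≡ 1
      sfB m m²∣B = sf m (ℕ.∣n⇒∣m*n p m²∣B)
      dq'≡B : d * q' ≡ B
      dq'≡B = ℕ.*-cancelˡ-≡ _ _ p ⦃ prime⇒nonZero pr ⦄ (trans (reorder p d q') dq≡)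
        where
        reorder : ∀ p d q → p * (d * q) ≡ d * (q * p)
        reorder = ℕR.solve-∀
      p∤q' : ¬ p ∣ₙ q'
      p∤q' p∣q' = p∤B (ℕ.∣-trans p∣q' (ℕ.divides d (sym dq'≡B)))
      q'≢0 : NonZero q'
      q'≢0 = ℕ.≢-nonZero λ { refl → p∤q' (ℕ._∣0 p) }

open CommonRoots
open ResidueCounts
open import Defs
open import Data.Nat as ℕ using (ℕ; NonZero; _*_; _≤_)
import Data.Nat.Properties as ℕ
import Data.Nat.Divisibility as ℕ
open import Data.Nat.Divisibility using (_∣_)
import Data.Nat.GCD as ℕ
open import Data.Nat.ListAction using (product)
open import Data.Nat.Primality using (Prime)
open import Data.Nat.Primality.Factorisation using (factorise; PrimeFactorisation)
open import Data.List using ([]; _∷_)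
open import Data.List.Relation.Unary.All using (All; []; _∷_)
open import Data.Integer as ℤ using (ℤ; +_; ∣_∣)
open import Data.Integer.Properties using (+-injective; abs-*)
open import Data.Integer.GCD using (gcd)
import Data.Integer.Divisibility.Signed as ℤ
open import Data.Integer.Tactic.RingSolver using (solve-∀)
open import Data.Product using (_×_; ∃; _,_; proj₁; proj₂; map; map₂)
open import Function using (_∘_; id)
open import Relation.Nullary using (¬_)
open import Relation.Unary using (Decidable)
open import Relation.Binary.PropositionalEquality

-- The counts for the common divisors of the values of f and g.

module _ {k l} (f : Poly k) (g : Poly l) where

  commonDivisor : ℤ → ℕ
  commonDivisor x = ℕ.gcd ∣ eval f x ∣ ∣ eval g x ∣

  commonDivisor-cong : ∀ {m x y} → + m ℤ.∣ x ℤ.- y → m ∣ commonDivisor x → m ∣ commonDivisor y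
  commonDivisor-cong {m} {x} {y} m∣x-y m∣G =
    ℕ.gcd-greatest (transfer f (ℕ.gcd[m,n]∣m ∣ eval f x ∣ ∣ eval g x ∣)) (transfer g (ℕ.gcd[m,n]∣n ∣ eval f x ∣ ∣ eval g x ∣))
    where
    cancel : ∀ a b → a ℤ.- (a ℤ.- b) ≡ b
    cancel = solve-∀
    transfer : ∀ {k} (h : Poly k) → commonDivisor x ∣ ∣ eval h x ∣ → m ∣ ∣ eval h y ∣
    transfer h G∣ = ℤ.∣⇒∣ᵤ (∣-respʳ (cancel (eval h x) (eval h y))
      (ℤ.∣m∣n⇒∣m-n (ℤ.∣ᵤ⇒∣ {i = eval h x} (ℕ.∣-trans m∣G G∣)) (eval-cong-∣ h x y m∣x-y)))

  open Counting commonDivisor commonDivisor-cong public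

  module _ (monicF : Monic f) (monicG : Monic g) (sf : SquareFree (resultant f g)) where

    commonDivisor∣resultant : ∀ x → commonDivisor x ∣ ∣ resultant f g ∣
    commonDivisor∣resultant x = ℤ.∣⇒∣ᵤ (common-divisor∣resultant f g monicF {+ commonDivisor x} x
      (ℤ.∣ᵤ⇒∣ (ℕ.gcd[m,n]∣m ∣ eval f x ∣ ∣ eval g x ∣)) (ℤ.∣ᵤ⇒∣ (ℕ.gcd[m,n]∣n ∣ eval f x ∣ ∣ eval g x ∣)))

    uniqueRoot : ∀ {p} → Prime p → p ∣ ∣ resultant f g ∣ → UniqueRoot p
    uniqueRoot {p} pr p∣r = existence , uniqueness
      where
      P∣r : + p ℤ.∣ resultant f g
      P∣r = ℤ.∣ᵤ⇒∣ p∣r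
      P²∤r : ¬ + p ℤ.* + p ℤ.∣ resultant f g
      P²∤r P²∣r = prime≢1 pr (sf p (subst (_∣ ∣ resultant f g ∣) (abs-* (+ p) (+ p)) (ℤ.∣⇒∣ᵤ P²∣r)))
      existence : ∃ λ x → p ∣ commonDivisor x
      existence = map₂ (λ (P∣fx , P∣gx) → ℕ.gcd-greatest (ℤ.∣⇒∣ᵤ P∣fx) (ℤ.∣⇒∣ᵤ P∣gx))
        (CommonRoot.common-root-exists pr f g P∣r P²∤r monicF)
      values : ∀ x → p ∣ commonDivisor x → + p ℤ.∣ eval f x × + p ℤ.∣ eval g x
      values x p∣ = ℤ.∣ᵤ⇒∣ (ℕ.∣-trans p∣ (ℕ.gcd[m,n]∣m ∣ eval f x ∣ ∣ eval g x ∣))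
                  , ℤ.∣ᵤ⇒∣ (ℕ.∣-trans p∣ (ℕ.gcd[m,n]∣n ∣ eval f x ∣ ∣ eval g x ∣))
      uniqueness : ∀ x y → p ∣ commonDivisor x → p ∣ commonDivisor y → + p ℤ.∣ y ℤ.- x
      uniqueness x y p∣Gx p∣Gy = CommonRoot.common-root-unique pr f g monicF monicG P∣r P²∤r x y
        (proj₁ (values x p∣Gx)) (proj₂ (values x p∣Gx)) (proj₁ (values y p∣Gy)) (proj₂ (values y p∣Gy))

    -- If the resultant were zero, the square of `0` would divide it.
    resultant≢0 : NonZero ∣ resultant f g ∣
    resultant≢0 = ℕ.≢-nonZero λ r≡0 → ℕ.0≢1+n (sf 0 (subst (0 ∣_) (sym r≡0) ℕ.∣-refl))

    countGcd≡primeProd : ∀ d q → d * q ≡ ∣ resultant f g ∣ → ∀ a →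
      countGcd f g a ∣ resultant f g ∣ d ≡ primeProd q
    countGcd≡primeProd d q dq≡r a = begin
      countGcd f g a R d
        ≡⟨ length-filter-applyUpTo _ id R ⟩
      sumTo R (λ i → indicator (gcd (eval f (a ℤ.+ + i)) (eval g (a ℤ.+ + i)) ℤ.≟ + d))
        ≡⟨ sumTo-cong R (λ i → indicator-⇔ (gcd (eval f (a ℤ.+ + i)) (eval g (a ℤ.+ + i)) ℤ.≟ + d) (ℕ.gcd (commonDivisor (a ℤ.+ + i)) R ℕ.≟ d)
             (λ eq → trans (absorb (a ℤ.+ + i)) (+-injective eq))
             (λ eq → cong +_ (trans (sym (absorb (a ℤ.+ + i))) eq))) ⟩
      count a R d
        ≡⟨ cong (λ n → count a n d) isFactorisation ⟩
      count a (product factors) d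
        ≡⟨ count≡primeProd factors factorsPrime (roots factors factorsPrime (subst (product factors ∣_) (sym isFactorisation) ℕ.∣-refl))
             (λ m → sf m ∘ subst (m * m ∣_) (sym isFactorisation)) d q (trans dq≡r isFactorisation) a ⟩
      primeProd q ∎
      where
      open ≡-Reasoning
      R : ℕ
      R = ∣ resultant f g ∣
      open PrimeFactorisation (factorise R ⦃ resultant≢0 ⦄)
      -- Every common divisor of values divides the resultant, so the gcd with `R` inside `count`
      -- loses nothing.
      absorb : ∀ x → ℕ.gcd (commonDivisor x) R ≡ commonDivisor x
      absorb x = ℕ.∣-antisym (ℕ.gcd[m,n]∣m (commonDivisor x) R)
        (ℕ.gcd-greatest ℕ.∣-refl (commonDivisor∣resultant x))
      roots : ∀ ps → All Prime ps → product ps ∣ R → All UniqueRoot ps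
      roots []       []         _   = []
      roots (p ∷ ps) (pr ∷ prs) ps∣ =
        uniqueRoot pr (ℕ.∣-trans (ℕ.m∣m*n (product ps)) ps∣) ∷ roots ps prs (ℕ.∣-trans (ℕ.n∣m*n p) ps∣)

theorem6 : ∀ {k l} (f : Poly k) (g : Poly l) → Monic f → Monic g →
    SquareFree (resultant f g) →
    ((d : ℕ) → 1 ≤ d → d ∣ ∣ resultant f g ∣ →
    ∃ λ (n : ℤ) → gcd (eval f n) (eval g n) ≡ + d)
    × ((d q : ℕ) → d * q ≡ ∣ resultant f g ∣ → (a : ℤ) →
    countGcd f g a ∣ resultant f g ∣ d ≡ primeProd q)
    × ((a : ℤ) → countGcd f g a ∣ resultant f g ∣ ∣ resultant f g ∣ ≡ 1)
-- For `d` equal to `r` the cofactor is `1`, and `primeProd 1` computes to `1`.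
theorem6 f g monicF monicG sf = attained , counted , λ a → counted r 1 (ℕ.*-identityʳ r) a
  where
  r : ℕ
  r = ∣ resultant f g ∣
  counted : (d q : ℕ) → d * q ≡ r → (a : ℤ) → countGcd f g a r d ≡ primeProd q
  counted = countGcd≡primeProd f g monicF monicG sf
  attained : (d : ℕ) → 1 ≤ d → d ∣ r → ∃ λ (n : ℤ) → gcd (eval f n) (eval g n) ≡ + d
  -- The count over the window starting at `0` equals `primeProd q`, which is nonzero, so some
  -- position in it is a witness.
  attained d _ (ℕ.divides q r≡qd) = map +_ id (sumTo-indicator≢0 r gcd≟d λ none →
    primeProd-≢0 q (trans (sym (counted d q (trans (ℕ.*-comm d q) (sym r≡qd)) ℤ.0ℤ))
      (trans (length-filter-applyUpTo gcd≟d id r) none)))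
    where
    gcd≟d : Decidable (λ i → gcd (eval f (+ i)) (eval g (+ i)) ≡ + d)
    gcd≟d i = gcd (eval f (+ i)) (eval g (+ i)) ℤ.≟ + d
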